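{- Let $F,H_1,\dots,H_m,G_1,\dots,G_n,F_{i,j}$ ($1\le i\le m$, $1\le j\le n$) be constant real symmetric $p\times p$ matrices and define $\mathcal{B}(\mathbf{x},\mathbf{y})=F+\sum_{i=1}^m x_iH_i+\sum_{j=1}^n y_jG_j+\sum_{i=1}^m\sum_{j=1}^n x_iy_jF_{i,j}$ for $\mathbf{x}\in\mathbb{R}^m,\mathbf{y}\in\mathbb{R}^n$. Let $\Gamma=\tfrac12(F_{i,j})_{i,j}$ be the $mp\times np$ block matrix with $(i,j)$ block $\tfrac12F_{i,j}$, $\Omega_1=(H_1\ \cdots\ H_m)$, $\Omega_2=(G_1\ \cdots\ G_n)$, and $M=\begin{pmatrix}0&\Gamma\\ \Gamma^{\mathsf T}&0\end{pmatrix}\in\mathcal{S}^{(m+n)p}$. Let $M=V^{\mathsf T}DV$ be an eigendecomposition with $V$ orthogonal and $D$ diagonal, let $D^+$ be obtained from $D$ by replacing negative entries with $0$, $D^-=D^+-D$, $M_1=V^{\mathsf T}D^+V$, $M_2=V^{\mathsf T}D^-V$. With $\mathbf{w}=\begin{pmatrix}\mathbf{x}\otimes I\\ \mathbf{y}\otimes I\end{pmatrix}$ ($I$ the $p\times p$ identity, $\mathbf{x},\mathbf{y}$ column vectors), define $\mathcal{B}^+(\mathbf{x},\mathbf{y})=\mathbf{w}^{\mathsf T}M_1\mathbf{w}+(\Omega_1\ \Omega_2)\mathbf{w}+F$ and $\mathcal{B}^-(\mathbf{x},\mathbf{y})=\mathbf{w}^{\mathsf T}M_2\mathbf{w}$.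 Then $\mathcal{B}(\mathbf{x},\mathbf{y})=\mathcal{B}^+(\mathbf{x},\mathbf{y})-\mathcal{B}^-(\mathbf{x},\mathbf{y})$ for all $(\mathbf{x},\mathbf{y})$, and both $\mathcal{B}^+$ and $\mathcal{B}^-$ are psd-convex on $\mathbb{R}^{m+n}$.
   Context: $\mathcal{S}^k$ is the space of real symmetric $k\times k$ matrices; $A\preceq B$ means $B-A$ is positive semidefinite. $\otimes$ is the Kronecker product. A matrix-valued function $\mathcal{C}\colon\mathbb{R}^N\to\mathcal{S}^p$ is psd-convex on a convex set $K$ if $\mathcal{C}(\mu\mathbf{z}_1+(1-\mu)\mathbf{z}_2)\preceq\mu\mathcal{C}(\mathbf{z}_1)+(1-\mu)\mathcal{C}(\mathbf{z}_2)$ for all $\mathbf{z}_1,\mathbf{z}_2\in K$, $\mu\in(0,1)$. -}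

module Defs where

open import Algebra.Bundles.Raw using (RawRing)
import Algebra.Definitions.RawMonoid as RawMonoidDefinitions
open import Data.Bool.Base using (if_then_else_)
open import Data.Fin.Base using (Fin; zero; combine; quotient; remainder)
import Data.Fin.Properties as Fin
open import Data.Nat.Base as ℕ using (ℕ)
import Data.Nat.Properties as ℕ
open import Data.Product.Base using (∃; ∃₂; _×_; _,_)
open import Data.Rational.Base as ℚ using (ℚ; 0ℚ; 1ℚ)
import Data.Rational.Properties as ℚ
open import Data.Rational.Solver using (module +-*-Solver)
open import Data.Sum.Base using (inj₁; inj₂)
open import Data.Vec.Functional using (Vector; _++_; take; drop)
open import Level using (Level; 0ℓ)
open import Relation.Binary.PropositionalEquality
  using (_≡_; _≢_; refl; sym; trans; cong; cong₂; subst)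
open import Relation.Nullary.Decidable.Core using (does)
open import Relation.Unary using (Pred)

-- The real numbers are Cauchy sequences of rationals, up to _≈_. Being Cauchy
-- is a data type rather than a function type so that the proofs stored in
-- arithmetic expressions are neutral; unfolding them makes normalisation
-- infeasible.
data IsCauchy (s : ℕ → ℚ) : Set where
  cauchy : (∀ ε → 0ℚ ℚ.< ε → ∃ λ N → ∀ i j → N ℕ.≤ i → N ℕ.≤ j →
             ℚ.∣ s i ℚ.- s j ∣ ℚ.≤ ε) →
           IsCauchy s

record ℝ : Set where
  constructor mkℝ
  field
    seq      : ℕ → ℚ
    isCauchy : IsCauchy seq

open ℝ public

private
  halves : ∀ ε → ℚ.½ ℚ.* ε ℚ.+ ℚ.½ ℚ.* ε ≡ ε
  halves = solve 1 (λ e → con ℚ.½ :* e :+ con ℚ.½ :* e := e) refl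
    where open +-*-Solver

  half-pos : ∀ {ε} → 0ℚ ℚ.< ε → 0ℚ ℚ.< ℚ.½ ℚ.* ε
  half-pos {ε} 0<ε = ℚ.positive⁻¹ _ {{ℚ.pos*pos⇒pos ℚ.½ ε {{ℚ.positive 0<ε}}}}

  ∣p∣≤ : ∀ {p q} → p ℚ.≤ q → ℚ.- p ℚ.≤ q → ℚ.∣ p ∣ ℚ.≤ q
  ∣p∣≤ {p} {q} p≤q -p≤q with ℚ.∣p∣≡p∨∣p∣≡-p p
  ... | inj₁ eq = subst (ℚ._≤ q) (sym eq) p≤q
  ... | inj₂ eq = subst (ℚ._≤ q) (sym eq) -p≤q

  p≤∣p∣ : ∀ p → p ℚ.≤ ℚ.∣ p ∣
  p≤∣p∣ p with ℚ.≤-total 0ℚ p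
  ... | inj₁ 0≤p = ℚ.≤-reflexive (sym (ℚ.0≤p⇒∣p∣≡p 0≤p))
  ... | inj₂ p≤0 = ℚ.≤-trans p≤0 (ℚ.0≤∣p∣ p)

  ∣p-q∣≡∣q-p∣ : ∀ p q → ℚ.∣ p ℚ.- q ∣ ≡ ℚ.∣ q ℚ.- p ∣
  ∣p-q∣≡∣q-p∣ p q = trans (sym (ℚ.∣-p∣≡∣p∣ (p ℚ.- q))) (cong ℚ.∣_∣ (eq p q))
    where
    open +-*-Solver
    eq : ∀ p q → ℚ.- (p ℚ.- q) ≡ q ℚ.- p
    eq = solve 2 (λ p q → :- (p :- q) := q :- p) refl

  p≤q+∣p-q∣ : ∀ p q → p ℚ.≤ q ℚ.+ ℚ.∣ p ℚ.- q ∣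
  p≤q+∣p-q∣ p q =
    subst (ℚ._≤ q ℚ.+ ℚ.∣ p ℚ.- q ∣) (eq p q) (ℚ.+-monoʳ-≤ q (p≤∣p∣ (p ℚ.- q)))
    where
    open +-*-Solver
    eq : ∀ p q → q ℚ.+ (p ℚ.- q) ≡ p
    eq = solve 2 (λ p q → q :+ (p :- q) := p) refl

  cauchy-const : ∀ q → IsCauchy (λ _ → q)
  cauchy-const q = cauchy λ ε 0<ε → 0 , λ _ _ _ _ →
    subst (λ d → ℚ.∣ d ∣ ℚ.≤ ε) (sym (ℚ.+-inverseʳ q)) (ℚ.<⇒≤ 0<ε)

  cauchy-neg : ∀ {s} → IsCauchy s → IsCauchy (λ i → ℚ.- s i)
  cauchy-neg {s} (cauchy cs) = cauchy λ ε 0<ε → let N , h = cs ε 0<ε in N , λ i j N≤i N≤j →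
    subst (ℚ._≤ ε)
      (trans (sym (ℚ.∣-p∣≡∣p∣ (s i ℚ.- s j)))
             (cong ℚ.∣_∣ (ℚ.neg-distrib-+ (s i) (ℚ.- s j))))
      (h i j N≤i N≤j)

  cauchy-nonexpansive : (f : ℚ → ℚ → ℚ) →
    (∀ a b c d → ℚ.∣ f a b ℚ.- f c d ∣ ℚ.≤ ℚ.∣ a ℚ.- c ∣ ℚ.+ ℚ.∣ b ℚ.- d ∣) →
    ∀ {s t} → IsCauchy s → IsCauchy t → IsCauchy (λ i → f (s i) (t i))
  cauchy-nonexpansive f f-ne {s} {t} (cauchy cs) (cauchy ct) = cauchy λ ε 0<ε →
    let N₁ , h₁ = cs (ℚ.½ ℚ.* ε) (half-pos 0<ε)
        N₂ , h₂ = ct (ℚ.½ ℚ.* ε) (half-pos 0<ε)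
    in N₁ ℕ.⊔ N₂ , λ i j N≤i N≤j →
      ℚ.≤-trans (f-ne (s i) (t i) (s j) (t j))
        (ℚ.≤-trans
          (ℚ.+-mono-≤ (h₁ i j (ℕ.m⊔n≤o⇒m≤o N₁ N₂ N≤i) (ℕ.m⊔n≤o⇒m≤o N₁ N₂ N≤j))
                      (h₂ i j (ℕ.m⊔n≤o⇒n≤o N₁ N₂ N≤i) (ℕ.m⊔n≤o⇒n≤o N₁ N₂ N≤j)))
          (ℚ.≤-reflexive (halves ε)))

  +-nonexpansive : ∀ a b c d →
    ℚ.∣ (a ℚ.+ b) ℚ.- (c ℚ.+ d) ∣ ℚ.≤ ℚ.∣ a ℚ.- c ∣ ℚ.+ ℚ.∣ b ℚ.- d ∣
  +-nonexpansive a b c d =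
    subst (λ e → ℚ.∣ e ∣ ℚ.≤ ℚ.∣ a ℚ.- c ∣ ℚ.+ ℚ.∣ b ℚ.- d ∣) (eq a b c d)
      (ℚ.∣p+q∣≤∣p∣+∣q∣ (a ℚ.- c) (b ℚ.- d))
    where
    open +-*-Solver
    eq : ∀ a b c d → (a ℚ.- c) ℚ.+ (b ℚ.- d) ≡ (a ℚ.+ b) ℚ.- (c ℚ.+ d)
    eq = solve 4 (λ a b c d → (a :- c) :+ (b :- d) := (a :+ b) :- (c :+ d)) refl

  ⊔-nonexpansive : ∀ a b c d →
    ℚ.∣ (a ℚ.⊔ b) ℚ.- (c ℚ.⊔ d) ∣ ℚ.≤ ℚ.∣ a ℚ.- c ∣ ℚ.+ ℚ.∣ b ℚ.- d ∣
  ⊔-nonexpansive a b c d = ∣p∣≤ (bound a b c d)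
    (begin
      ℚ.- ((a ℚ.⊔ b) ℚ.- (c ℚ.⊔ d))    ≡⟨ neg-sub (a ℚ.⊔ b) (c ℚ.⊔ d) ⟩
      (c ℚ.⊔ d) ℚ.- (a ℚ.⊔ b)          ≤⟨ bound c d a b ⟩
      ℚ.∣ c ℚ.- a ∣ ℚ.+ ℚ.∣ d ℚ.- b ∣  ≡⟨ cong₂ ℚ._+_ (∣p-q∣≡∣q-p∣ c a) (∣p-q∣≡∣q-p∣ d b) ⟩
      ℚ.∣ a ℚ.- c ∣ ℚ.+ ℚ.∣ b ℚ.- d ∣  ∎)
    where
    open ℚ.≤-Reasoning
    open +-*-Solver
    neg-sub : ∀ p q → ℚ.- (p ℚ.- q) ≡ q ℚ.- p
    neg-sub = solve 2 (λ p q → :- (p :- q) := q :- p) refl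

    cancel : ∀ p e → (p ℚ.+ e) ℚ.- p ≡ e
    cancel = solve 2 (λ p e → (p :+ e) :- p := e) refl

    bound : ∀ a b c d →
      (a ℚ.⊔ b) ℚ.- (c ℚ.⊔ d) ℚ.≤ ℚ.∣ a ℚ.- c ∣ ℚ.+ ℚ.∣ b ℚ.- d ∣
    bound a b c d = ℚ.≤-trans (ℚ.+-monoˡ-≤ (ℚ.- (c ℚ.⊔ d)) a⊔b≤)
                              (ℚ.≤-reflexive (cancel (c ℚ.⊔ d) e))
      where
      x = ℚ.∣ a ℚ.- c ∣
      y = ℚ.∣ b ℚ.- d ∣
      e = x ℚ.+ y

      x≤e : x ℚ.≤ e
      x≤e = subst (ℚ._≤ e) (ℚ.+-identityʳ x) (ℚ.+-monoʳ-≤ x (ℚ.0≤∣p∣ (b ℚ.- d)))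

      y≤e : y ℚ.≤ e
      y≤e = subst (ℚ._≤ e) (ℚ.+-identityˡ y) (ℚ.+-monoˡ-≤ y (ℚ.0≤∣p∣ (a ℚ.- c)))

      a⊔b≤ : a ℚ.⊔ b ℚ.≤ (c ℚ.⊔ d) ℚ.+ e
      a⊔b≤ = ℚ.⊔-lub
        (ℚ.≤-trans (p≤q+∣p-q∣ a c) (ℚ.+-mono-≤ (ℚ.p≤p⊔q c d) x≤e))
        (ℚ.≤-trans (p≤q+∣p-q∣ b d) (ℚ.+-mono-≤ (ℚ.p≤q⊔p c d) y≤e))

  cauchy-+ : ∀ {s t} → IsCauchy s → IsCauchy t → IsCauchy (λ i → s i ℚ.+ t i)
  cauchy-+ cs@(cauchy _) ct@(cauchy _) =
    cauchy-nonexpansive ℚ._+_ +-nonexpansive cs ct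

  cauchy-⊔ : ∀ {s t} → IsCauchy s → IsCauchy t → IsCauchy (λ i → s i ℚ.⊔ t i)
  cauchy-⊔ cs@(cauchy _) ct@(cauchy _) =
    cauchy-nonexpansive ℚ._⊔_ ⊔-nonexpansive cs ct

  eventually-bounded : ∀ {s} → IsCauchy s →
    ∃₂ λ K N → 0ℚ ℚ.< K × (∀ i → N ℕ.≤ i → ℚ.∣ s i ∣ ℚ.≤ K)
  eventually-bounded {s} (cauchy cs) =
    let N , h = cs 1ℚ (ℚ.positive⁻¹ 1ℚ)
    in ℚ.∣ s N ∣ ℚ.+ 1ℚ , N
      , ℚ.+-mono-≤-< (ℚ.0≤∣p∣ (s N)) (ℚ.positive⁻¹ 1ℚ)
      , λ i N≤i → ℚ.≤-trans
          (subst (λ d → ℚ.∣ d ∣ ℚ.≤ ℚ.∣ s N ∣ ℚ.+ ℚ.∣ s i ℚ.- s N ∣) (eq (s N) (s i))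
            (ℚ.∣p+q∣≤∣p∣+∣q∣ (s N) (s i ℚ.- s N)))
          (ℚ.+-monoʳ-≤ ℚ.∣ s N ∣ (h i N N≤i ℕ.≤-refl))
    where
    open +-*-Solver
    eq : ∀ p q → p ℚ.+ (q ℚ.- p) ≡ q
    eq = solve 2 (λ p q → p :+ (q :- p) := q) refl

  ∣*∣-mono-≤ : ∀ {p q K δ} → ℚ.∣ p ∣ ℚ.≤ K → ℚ.∣ q ∣ ℚ.≤ δ →
    ℚ.∣ p ℚ.* q ∣ ℚ.≤ K ℚ.* δ
  ∣*∣-mono-≤ {p} {q} {K} {δ} p≤K q≤δ = begin
    ℚ.∣ p ℚ.* q ∣          ≡⟨ ℚ.∣p*q∣≡∣p∣*∣q∣ p q ⟩
    ℚ.∣ p ∣ ℚ.* ℚ.∣ q ∣    ≤⟨ ℚ.*-monoˡ-≤-nonNeg ℚ.∣ p ∣ {{ℚ.∣-∣-nonNeg p}} q≤δ ⟩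
    ℚ.∣ p ∣ ℚ.* δ          ≤⟨ ℚ.*-monoʳ-≤-nonNeg δ {{ℚ.nonNegative 0≤δ}} p≤K ⟩
    K ℚ.* δ                ∎
    where
    open ℚ.≤-Reasoning
    0≤δ : 0ℚ ℚ.≤ δ
    0≤δ = ℚ.≤-trans (ℚ.0≤∣p∣ q) q≤δ

  *-difference-≤ : ∀ a b c d K L δ →
    ℚ.∣ a ∣ ℚ.≤ K → ℚ.∣ d ∣ ℚ.≤ L → ℚ.∣ a ℚ.- c ∣ ℚ.≤ δ → ℚ.∣ b ℚ.- d ∣ ℚ.≤ δ →
    ℚ.∣ a ℚ.* b ℚ.- c ℚ.* d ∣ ℚ.≤ (K ℚ.+ L) ℚ.* δ
  *-difference-≤ a b c d K L δ a≤K d≤L a-c≤δ b-d≤δ = begin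
    ℚ.∣ a ℚ.* b ℚ.- c ℚ.* d ∣
      ≡⟨ cong ℚ.∣_∣ (split a b c d) ⟩
    ℚ.∣ a ℚ.* (b ℚ.- d) ℚ.+ d ℚ.* (a ℚ.- c) ∣
      ≤⟨ ℚ.∣p+q∣≤∣p∣+∣q∣ (a ℚ.* (b ℚ.- d)) (d ℚ.* (a ℚ.- c)) ⟩
    ℚ.∣ a ℚ.* (b ℚ.- d) ∣ ℚ.+ ℚ.∣ d ℚ.* (a ℚ.- c) ∣
      ≤⟨ ℚ.+-mono-≤ (∣*∣-mono-≤ {a} {b ℚ.- d} a≤K b-d≤δ)
                    (∣*∣-mono-≤ {d} {a ℚ.- c} d≤L a-c≤δ) ⟩
    K ℚ.* δ ℚ.+ L ℚ.* δ
      ≡⟨ ℚ.*-distribʳ-+ δ K L ⟨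
    (K ℚ.+ L) ℚ.* δ ∎
    where
    open ℚ.≤-Reasoning
    split : ∀ a b c d →
      a ℚ.* b ℚ.- c ℚ.* d ≡ a ℚ.* (b ℚ.- d) ℚ.+ d ℚ.* (a ℚ.- c)
    split = solve 4 (λ a b c d →
      a :* b :- c :* d := a :* (b :- d) :+ d :* (a :- c)) refl
      where open +-*-Solver

  quotient-pos : ∀ K ε → 0ℚ ℚ.< K → 0ℚ ℚ.< ε →
    ∃ λ δ → 0ℚ ℚ.< δ × K ℚ.* δ ≡ ε
  quotient-pos K ε 0<K 0<ε = ℚ.1/ K ℚ.* ε
    , ℚ.positive⁻¹ _ {{ℚ.pos*pos⇒pos (ℚ.1/ K) {{ℚ.1/pos⇒pos K}} ε {{ℚ.positive 0<ε}}}}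
    , trans (sym (ℚ.*-assoc K (ℚ.1/ K) ε))
        (trans (cong (ℚ._* ε) (ℚ.*-inverseʳ K)) (ℚ.*-identityˡ ε))
    where
    instance
      K-pos : ℚ.Positive K
      K-pos = ℚ.positive 0<K
      K-nonZero : ℚ.NonZero K
      K-nonZero = ℚ.pos⇒nonZero K

  cauchy-* : ∀ {s t} → IsCauchy s → IsCauchy t → IsCauchy (λ i → s i ℚ.* t i)
  cauchy-* {s} {t} cs′@(cauchy cs) ct′@(cauchy ct) = cauchy λ ε 0<ε →
    let K , N₁ , 0<K , s≤K = eventually-bounded cs′
        L , N₂ , 0<L , t≤L = eventually-bounded ct′
        0<K+L              = ℚ.+-mono-< {0ℚ} {K} {0ℚ} {L} 0<K 0<L
        δ , 0<δ , [K+L]δ≡ε = quotient-pos (K ℚ.+ L) ε 0<K+L 0<ε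
        N₃ , h₃            = cs δ 0<δ
        N₄ , h₄            = ct δ 0<δ
        M₁ = N₁ ℕ.⊔ N₂
        M₂ = N₃ ℕ.⊔ N₄
    in M₁ ℕ.⊔ M₂ , λ i j M≤i M≤j →
      let M₁≤i = ℕ.m⊔n≤o⇒m≤o M₁ M₂ M≤i
          M₂≤i = ℕ.m⊔n≤o⇒n≤o M₁ M₂ M≤i
          M₁≤j = ℕ.m⊔n≤o⇒m≤o M₁ M₂ M≤j
          M₂≤j = ℕ.m⊔n≤o⇒n≤o M₁ M₂ M≤j
      in subst (ℚ.∣ s i ℚ.* t i ℚ.- s j ℚ.* t j ∣ ℚ.≤_) [K+L]δ≡ε
           (*-difference-≤ (s i) (t i) (s j) (t j) K L δ
             (s≤K i (ℕ.m⊔n≤o⇒m≤o N₁ N₂ M₁≤i))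
             (t≤L j (ℕ.m⊔n≤o⇒n≤o N₁ N₂ M₁≤j))
             (h₃ i j (ℕ.m⊔n≤o⇒m≤o N₃ N₄ M₂≤i) (ℕ.m⊔n≤o⇒m≤o N₃ N₄ M₂≤j))
             (h₄ i j (ℕ.m⊔n≤o⇒n≤o N₃ N₄ M₂≤i) (ℕ.m⊔n≤o⇒n≤o N₃ N₄ M₂≤j)))

infix  4 _≈_ _≤_ _<_
infixl 6 _+_ _-_ _⊔_
infixl 7 _*_
infix  8 -_

fromℚ : ℚ → ℝ
fromℚ q = mkℝ (λ _ → q) (cauchy-const q)

0ℝ 1ℝ ½ℝ : ℝ
0ℝ = fromℚ 0ℚ
1ℝ = fromℚ 1ℚ
½ℝ = fromℚ ℚ.½

-_ : ℝ → ℝ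
- x = mkℝ (λ i → ℚ.- seq x i) (cauchy-neg (isCauchy x))

_+_ _*_ _-_ _⊔_ : ℝ → ℝ → ℝ
x + y = mkℝ (λ i → seq x i ℚ.+ seq y i) (cauchy-+ (isCauchy x) (isCauchy y))
x * y = mkℝ (λ i → seq x i ℚ.* seq y i) (cauchy-* (isCauchy x) (isCauchy y))
x - y = x + (- y)
x ⊔ y = mkℝ (λ i → seq x i ℚ.⊔ seq y i) (cauchy-⊔ (isCauchy x) (isCauchy y))

_≈_ _≤_ _<_ : ℝ → ℝ → Set
x ≈ y = ∀ ε → 0ℚ ℚ.< ε →
  ∃ λ N → ∀ i → N ℕ.≤ i → ℚ.∣ seq x i ℚ.- seq y i ∣ ℚ.≤ ε
x ≤ y = ∀ ε → 0ℚ ℚ.< ε →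
  ∃ λ N → ∀ i → N ℕ.≤ i → seq x i ℚ.≤ seq y i ℚ.+ ε
x < y = ∃ λ ε → 0ℚ ℚ.< ε ×
  (∃ λ N → ∀ i → N ℕ.≤ i → seq x i ℚ.+ ε ℚ.≤ seq y i)

ℝ-rawRing : RawRing 0ℓ 0ℓ
ℝ-rawRing = record
  { Carrier = ℝ
  ; _≈_     = _≈_
  ; _+_     = _+_
  ; _*_     = _*_
  ; -_      = -_
  ; 0#      = 0ℝ
  ; 1#      = 1ℝ
  }

open RawMonoidDefinitions (RawRing.+-rawMonoid ℝ-rawRing) public
  using () renaming (sum to ∑)

private
  variable
    k l m n p q N : ℕ
    ℓ : Level

Matrix : ℕ → ℕ → Set
Matrix m n = Vector (Vector ℝ n) m

infix  4 _≋_ _⪯_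
infixl 6 _+ᵛ_ _+ᴹ_ _-ᴹ_
infixl 7 _*ᴹ_
infixr 7 _·ᵛ_ _·ᴹ_
infixl 7 _⊗_ _⊗ᶜ_
infixr 5 _∥_
infix  9 _ᵀ

_+ᵛ_ : Vector ℝ n → Vector ℝ n → Vector ℝ n
(u +ᵛ v) i = u i + v i

_·ᵛ_ : ℝ → Vector ℝ n → Vector ℝ n
(a ·ᵛ v) i = a * v i

_≋_ : Matrix m n → Matrix m n → Set
A ≋ B = ∀ i j → A i j ≈ B i j

0ᴹ : Matrix m n
0ᴹ _ _ = 0ℝ

1ᴹ : Matrix n n
1ᴹ i j = if does (i Fin.≟ j) then 1ℝ else 0ℝ

_+ᴹ_ _-ᴹ_ : Matrix m n → Matrix m n → Matrix m n
(A +ᴹ B) i j = A i j + B i j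
(A -ᴹ B) i j = A i j - B i j

_·ᴹ_ : ℝ → Matrix m n → Matrix m n
(a ·ᴹ A) i j = a * A i j

_*ᴹ_ : Matrix m k → Matrix k n → Matrix m n
(A *ᴹ B) i j = ∑ λ r → A i r * B r j

_ᵀ : Matrix m n → Matrix n m
(A ᵀ) i j = A j i

∑ᴹ : Vector (Matrix m n) k → Matrix m n
∑ᴹ A i j = ∑ λ r → A r i j

-- Since a matrix is the vector of its rows, vertical stacking is _++_ itself.
_∥_ : Matrix k m → Matrix k n → Matrix k (m ℕ.+ n)
(A ∥ B) i = A i ++ B i

blocks : (Fin m → Fin n → Matrix p q) → Matrix (m ℕ.* p) (n ℕ.* q)
blocks {m} {n} {p} {q} A i j =
  A (quotient p i) (quotient q j) (remainder {m} p i) (remainder {n} q j)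

blockRow : Vector (Matrix p q) n → Matrix p (n ℕ.* q)
blockRow {q = q} {n = n} A i j = A (quotient q j) i (remainder {n} q j)

_⊗_ : Matrix m n → Matrix p q → Matrix (m ℕ.* p) (n ℕ.* q)
A ⊗ B = blocks λ i j → A i j ·ᴹ B

column : Vector ℝ m → Matrix m 1
column x i _ = x i

-- The product column x ⊗ A, which has 1 * q columns, reindexed by Fin q
-- along the bijection combine zero : Fin q → Fin (1 * q).
_⊗ᶜ_ : Vector ℝ m → Matrix p q → Matrix (m ℕ.* p) q
(x ⊗ᶜ A) i j = (column x ⊗ A) i (combine {1} zero j)

IsSymmetric : Matrix n n → Set
IsSymmetric A = A ≋ A ᵀ

IsOrthogonal : Matrix n n → Set
IsOrthogonal V = (V ᵀ *ᴹ V ≋ 1ᴹ) × (V *ᴹ V ᵀ ≋ 1ᴹ)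

IsDiagonal : Matrix n n → Set
IsDiagonal D = ∀ i j → i ≢ j → D i j ≈ 0ℝ

record IsEigendecomposition (M V D : Matrix n n) : Set where
  field
    orthogonal : IsOrthogonal V
    diagonal   : IsDiagonal D
    factors    : M ≋ V ᵀ *ᴹ D *ᴹ V

IsPSD : Matrix n n → Set
IsPSD {n} A = IsSymmetric A ×
  (∀ (v : Vector ℝ n) → 0ℝ ≤ ∑ λ i → ∑ λ j → v i * A i j * v j)

_⪯_ : Matrix n n → Matrix n n → Set
A ⪯ B = IsPSD (B -ᴹ A)

IsConvex : Pred (Vector ℝ N) ℓ → Set ℓ
IsConvex K = ∀ z₁ z₂ → K z₁ → K z₂ → ∀ μ → 0ℝ < μ → μ < 1ℝ →
  K (μ ·ᵛ z₁ +ᵛ (1ℝ - μ) ·ᵛ z₂)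

record PSDConvexOn (K : Pred (Vector ℝ N) ℓ)
                   (C : Vector ℝ N → Matrix p p) : Set ℓ where
  field
    domainConvex    : IsConvex K
    symmetricValued : ∀ z → IsSymmetric (C z)
    convex          : ∀ z₁ z₂ → K z₁ → K z₂ → ∀ μ → 0ℝ < μ → μ < 1ℝ →
      C (μ ·ᵛ z₁ +ᵛ (1ℝ - μ) ·ᵛ z₂) ⪯ μ ·ᴹ C z₁ +ᴹ (1ℝ - μ) ·ᴹ C z₂

onJoint : (Vector ℝ m → Vector ℝ n → Matrix p p) →
          Vector ℝ (m ℕ.+ n) → Matrix p p
onJoint {m} C z = C (take m z) (drop m z)

ℬ : (F : Matrix p p) (H : Vector (Matrix p p) m) (G : Vector (Matrix p p) n)
    (E : Fin m → Fin n → Matrix p p) →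
    Vector ℝ m → Vector ℝ n → Matrix p p
ℬ F H G E x y =
  F +ᴹ ∑ᴹ (λ i → x i ·ᴹ H i)
    +ᴹ ∑ᴹ (λ j → y j ·ᴹ G j)
    +ᴹ ∑ᴹ (λ i → ∑ᴹ λ j → (x i * y j) ·ᴹ E i j)

Γ : (Fin m → Fin n → Matrix p p) → Matrix (m ℕ.* p) (n ℕ.* p)
Γ E = blocks λ i j → ½ℝ ·ᴹ E i j

𝑀 : (Fin m → Fin n → Matrix p p) →
    Matrix (m ℕ.* p ℕ.+ n ℕ.* p) (m ℕ.* p ℕ.+ n ℕ.* p)
𝑀 E = (0ᴹ ∥ Γ E) ++ (Γ E ᵀ ∥ 0ᴹ)

𝑤 : Vector ℝ m → Vector ℝ n → Matrix (m ℕ.* p ℕ.+ n ℕ.* p) p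
𝑤 x y = (x ⊗ᶜ 1ᴹ) ++ (y ⊗ᶜ 1ᴹ)

-- The order on ℝ is undecidable, so "replace negative entries by 0" is
-- the entrywise maximum with 0.
_⁺ _⁻ : Matrix n n → Matrix n n
(D ⁺) i j = D i j ⊔ 0ℝ
D ⁻       = D ⁺ -ᴹ D

ℬ⁺ : (F : Matrix p p) (H : Vector (Matrix p p) m) (G : Vector (Matrix p p) n)
     (V D : Matrix (m ℕ.* p ℕ.+ n ℕ.* p) (m ℕ.* p ℕ.+ n ℕ.* p)) →
     Vector ℝ m → Vector ℝ n → Matrix p p
ℬ⁺ F H G V D x y =
  𝑤 x y ᵀ *ᴹ (V ᵀ *ᴹ D ⁺ *ᴹ V) *ᴹ 𝑤 x y
    +ᴹ (blockRow H ∥ blockRow G) *ᴹ 𝑤 x y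
    +ᴹ F

ℬ⁻ : (V D : Matrix (m ℕ.* p ℕ.+ n ℕ.* p) (m ℕ.* p ℕ.+ n ℕ.* p)) →
     Vector ℝ m → Vector ℝ n → Matrix p p
ℬ⁻ V D x y = 𝑤 x y ᵀ *ᴹ (V ᵀ *ᴹ D ⁻ *ᴹ V) *ᴹ 𝑤 x y

{-# OPTIONS --safe #-}

-- A congruence WᵀAW is a quadratic function of W with the exact convexity gap
--   μ W₁ᵀAW₁ + (1-μ) W₂ᵀAW₂ - WᵀAW = μ(1-μ) (W₁-W₂)ᵀA(W₁-W₂),   W = μW₁ + (1-μ)W₂,
-- which is positive semidefinite when A is. Here A is VᵀD⁺V or VᵀD⁻V, and W = 𝑤 is
-- linear in (x, y); the terms Ωw and F are affine and contribute no gap. The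
-- decomposition holds because D = D⁺ - D⁻ and wᵀMw is the bilinear part of ℬ: each
-- of the two off-diagonal blocks of M contributes half of it, the lower one by
-- symmetry of the E i j.

module Submission where

open import Defs
open import Algebra.Bundles using (CommutativeRing)
import Algebra.Properties.Semiring.Sum as SemiringSum
open import Data.Fin.Base as Fin using (Fin; combine; quotient; remainder; splitAt; _↑ˡ_; _↑ʳ_)
import Data.Fin.Properties as Fin
open import Data.Nat.Base as ℕ using (ℕ; zero; suc)
import Data.Nat.Properties as ℕ
open import Data.Product.Base using (∃₂; _×_; _,_; proj₁; proj₂)
open import Data.Rational.Base as ℚ using (ℚ; 0ℚ; 1ℚ)
import Data.Rational.Properties as ℚ
open import Data.Rational.Solver using (module +-*-Solver)
open import Data.Sum.Base using (inj₁; inj₂)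
open import Data.Unit.Base using (tt)
open import Data.Vec.Functional using (Vector; take; drop)
open import Data.Vec.Functional.Properties using (lookup-++ˡ; lookup-++ʳ)
open import Function.Base using (_∘_)
open import Level using (0ℓ)
open import Relation.Binary.Bundles using (Setoid)
open import Relation.Binary.PropositionalEquality
  using (_≡_; _≢_; refl; sym; trans; cong; cong₂; cong-app; subst)
import Relation.Binary.Reasoning.Setoid as SetoidReasoning
open import Relation.Nullary.Decidable.Core using (yes; no)
open import Relation.Unary using (U)

-- Real arithmetic acts on Cauchy sequences term by term, so a polynomial identity between reals
-- reduces to the same identity between the rational terms, which the ring solver proves. Limits
-- enter only through the compatibility of the operations with equality and through the order.
--
-- The order cannot be decided, so no argument may split on the sign of a real. Nonnegativity is
-- instead read off from sequences whose terms are all nonnegative: a square, a maximum with 0, or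
-- max(d, 0) - d. The last two are the diagonal entries of `D ⁺` and `D ⁻`, which makes these
-- matrices positive semidefinite without knowing the sign of any eigenvalue.
--
-- Congruence occurs at three levels: by `V`, by `𝑤`, and by a test vector regarded as a one-column
-- matrix. Nested congruences merge into one by the product of the matrices, which carries
-- semidefiniteness from the diagonal matrices to the values of the quadratic maps.

open +-*-Solver using (solve; _:=_; _:+_; _:*_; _:-_; :-_; con)

-- Real numbers

infix 4 _≃_

-- _≈_ unfolds to a function type, from which the two sides cannot be inferred.
record _≃_ (x y : ℝ) : Set where
  constructor ≈⇒≃
  field ≃⇒≈ : x ≈ y

open _≃_ public

private
  half-pos : ∀ {ε} → 0ℚ ℚ.< ε → 0ℚ ℚ.< ℚ.½ ℚ.* ε
  half-pos {ε} 0<ε = ℚ.positive⁻¹ _ {{ℚ.pos*pos⇒pos ℚ.½ ε {{ℚ.positive 0<ε}}}}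

  halves : ∀ ε → ℚ.½ ℚ.* ε ℚ.+ ℚ.½ ℚ.* ε ≡ ε
  halves = solve 1 (λ e → con ℚ.½ :* e :+ con ℚ.½ :* e := e) refl

-- The bridge from rational to real identities: equal terms leave no error at any tolerance. The
-- ring laws and every call of the solver on reals pass through it.
pointwise : ∀ {x y} → (∀ i → seq x i ≡ seq y i) → x ≃ y
pointwise {x} {y} x≗y = ≈⇒≃ λ ε 0<ε → 0 , λ i _ →
  subst (λ q → ℚ.∣ q ∣ ℚ.≤ ε)
    (sym (trans (cong (ℚ._- seq y i) (x≗y i)) (ℚ.+-inverseʳ (seq y i))))
    (ℚ.<⇒≤ 0<ε)

≃-refl : ∀ {x} → x ≃ x
≃-refl = pointwise λ _ → refl

≡⇒≃ : ∀ {x y} → x ≡ y → x ≃ y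
≡⇒≃ refl = ≃-refl

≃-sym : ∀ {x y} → x ≃ y → y ≃ x
≃-sym {x} {y} (≈⇒≃ x≈y) = ≈⇒≃ λ ε 0<ε → let N , h = x≈y ε 0<ε in N , λ i N≤i →
  subst (ℚ._≤ ε)
    (trans (sym (ℚ.∣-p∣≡∣p∣ (seq x i ℚ.- seq y i)))
           (cong ℚ.∣_∣ (neg-sub (seq x i) (seq y i))))
    (h i N≤i)
  where
  neg-sub : ∀ p q → ℚ.- (p ℚ.- q) ≡ q ℚ.- p
  neg-sub = solve 2 (λ p q → :- (p :- q) := q :- p) refl

-- The one ε/2 argument behind transitivity, sums and negation: the error of the conclusion is the
-- sum of the two given errors.
≃-combine : ∀ {x y u v z w} →
  (∀ i → seq z i ℚ.- seq w i ≡ (seq x i ℚ.- seq y i) ℚ.+ (seq u i ℚ.- seq v i)) →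
  x ≃ y → u ≃ v → z ≃ w
≃-combine {x} {y} {u} {v} {z} {w} eq (≈⇒≃ x≈y) (≈⇒≃ u≈v) = ≈⇒≃ λ ε 0<ε →
  let N₁ , h₁ = x≈y (ℚ.½ ℚ.* ε) (half-pos 0<ε)
      N₂ , h₂ = u≈v (ℚ.½ ℚ.* ε) (half-pos 0<ε)
  in N₁ ℕ.⊔ N₂ , λ i N≤i →
    let open ℚ.≤-Reasoning
        a = seq x i ℚ.- seq y i
        b = seq u i ℚ.- seq v i
    in begin
      ℚ.∣ seq z i ℚ.- seq w i ∣      ≡⟨ cong ℚ.∣_∣ (eq i) ⟩
      ℚ.∣ a ℚ.+ b ∣                  ≤⟨ ℚ.∣p+q∣≤∣p∣+∣q∣ a b ⟩
      ℚ.∣ a ∣ ℚ.+ ℚ.∣ b ∣            ≤⟨ ℚ.+-mono-≤ (h₁ i (ℕ.m⊔n≤o⇒m≤o N₁ N₂ N≤i))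
                                                   (h₂ i (ℕ.m⊔n≤o⇒n≤o N₁ N₂ N≤i)) ⟩
      ℚ.½ ℚ.* ε ℚ.+ ℚ.½ ℚ.* ε        ≡⟨ halves ε ⟩
      ε                              ∎

≃-trans : ∀ {x y z} → x ≃ y → y ≃ z → x ≃ z
≃-trans {x} {y} {z} = ≃-combine λ i →
  solve 3 (λ a b c → a :- c := (a :- b) :+ (b :- c)) refl (seq x i) (seq y i) (seq z i)

+-cong : ∀ {x y u v} → x ≃ y → u ≃ v → x + u ≃ y + v
+-cong {x} {y} {u} {v} = ≃-combine λ i →
  solve 4 (λ a b c d → a :+ c :- (b :+ d) := (a :- b) :+ (c :- d)) refl
    (seq x i) (seq y i) (seq u i) (seq v i)

-‿cong : ∀ {x y} → x ≃ y → - x ≃ - y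
-‿cong {x} {y} x≃y = ≃-combine
  (λ i → solve 2 (λ a b → :- a :- (:- b) := (b :- a) :+ (con 0ℚ :- con 0ℚ)) refl
    (seq x i) (seq y i))
  -- The error of `- x` against `- y` is that of `y` against `x`; a zero error fills the second
  -- slot.
  (≃-sym x≃y) (≃-refl {0ℝ})

-- From the index `N` for tolerance 1 onwards, every term lies within 1 of `s N`. The bound makes
-- multiplication by a fixed real continuous.
eventually-bounded : ∀ x →
  ∃₂ λ K N → 0ℚ ℚ.< K × (∀ i → N ℕ.≤ i → ℚ.∣ seq x i ∣ ℚ.≤ K)
eventually-bounded (mkℝ s (cauchy cs)) =
  let N , h = cs 1ℚ (ℚ.positive⁻¹ 1ℚ)
  in ℚ.∣ s N ∣ ℚ.+ 1ℚ , N
    , ℚ.+-mono-≤-< (ℚ.0≤∣p∣ (s N)) (ℚ.positive⁻¹ 1ℚ)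
    , λ i N≤i → ℚ.≤-trans
        (subst (λ d → ℚ.∣ d ∣ ℚ.≤ ℚ.∣ s N ∣ ℚ.+ ℚ.∣ s i ℚ.- s N ∣) (eq (s N) (s i))
          (ℚ.∣p+q∣≤∣p∣+∣q∣ (s N) (s i ℚ.- s N)))
        (ℚ.+-monoʳ-≤ ℚ.∣ s N ∣ (h i N N≤i ℕ.≤-refl))
  where
  eq : ∀ p q → p ℚ.+ (q ℚ.- p) ≡ q
  eq = solve 2 (λ p q → p :+ (q :- p) := q) refl

*-congˡ : ∀ x {y z} → y ≃ z → x * y ≃ x * z
*-congˡ x {y} {z} (≈⇒≃ y≈z) with eventually-bounded x
... | K , N₁ , 0<K , x≤K = ≈⇒≃ λ ε 0<ε →
  -- The tolerance is ε/K because the factor `x` magnifies an error at most `K` times on its tail.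
  let N₂ , h = y≈z (ℚ.1/ K ℚ.* ε)
                 (ℚ.positive⁻¹ _ {{ℚ.pos*pos⇒pos (ℚ.1/ K) {{ℚ.1/pos⇒pos K}} ε {{ℚ.positive 0<ε}}}})
  in N₁ ℕ.⊔ N₂ , λ i N≤i →
    let open ℚ.≤-Reasoning
        a = seq x i
        b = seq y i ℚ.- seq z i
    in begin
      ℚ.∣ a ℚ.* seq y i ℚ.- a ℚ.* seq z i ∣
        ≡⟨ cong ℚ.∣_∣ (solve 3 (λ a b c → a :* b :- a :* c := a :* (b :- c)) refl
                         a (seq y i) (seq z i)) ⟩
      ℚ.∣ a ℚ.* b ∣              ≡⟨ ℚ.∣p*q∣≡∣p∣*∣q∣ a b ⟩
      ℚ.∣ a ∣ ℚ.* ℚ.∣ b ∣        ≤⟨ ℚ.*-monoʳ-≤-nonNeg ℚ.∣ b ∣ {{ℚ.∣-∣-nonNeg b}}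
                                      (x≤K i (ℕ.m⊔n≤o⇒m≤o N₁ N₂ N≤i)) ⟩
      K ℚ.* ℚ.∣ b ∣              ≤⟨ ℚ.*-monoˡ-≤-nonNeg K {{ℚ.pos⇒nonNeg K}}
                                      (h i (ℕ.m⊔n≤o⇒n≤o N₁ N₂ N≤i)) ⟩
      K ℚ.* (ℚ.1/ K ℚ.* ε)       ≡⟨ ℚ.*-assoc K (ℚ.1/ K) ε ⟨
      K ℚ.* ℚ.1/ K ℚ.* ε         ≡⟨ cong (ℚ._* ε) (ℚ.*-inverseʳ K) ⟩
      1ℚ ℚ.* ε                   ≡⟨ ℚ.*-identityˡ ε ⟩
      ε                          ∎
  where
  instance
    K-pos : ℚ.Positive K
    K-pos = ℚ.positive 0<K
    K-nonZero : ℚ.NonZero K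
    K-nonZero = ℚ.pos⇒nonZero K

*-comm : ∀ x y → x * y ≃ y * x
*-comm x y = pointwise λ i → ℚ.*-comm (seq x i) (seq y i)

*-cong : ∀ {x y u v} → x ≃ y → u ≃ v → x * u ≃ y * v
*-cong {x} {y} {u} {v} x≃y u≃v =
  ≃-trans (*-congˡ x u≃v) (≃-trans (*-comm x v) (≃-trans (*-congˡ v x≃y) (*-comm v y)))

ℝ-commutativeRing : CommutativeRing 0ℓ 0ℓ
ℝ-commutativeRing = record
  { Carrier = ℝ
  ; _≈_ = _≃_
  ; _+_ = _+_
  ; _*_ = _*_
  ; -_ = -_
  ; 0# = 0ℝ
  ; 1# = 1ℝ
  ; isCommutativeRing = record
    { isRing = record
      { +-isAbelianGroup = record
        { isGroup = record
          { isMonoid = record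
            { isSemigroup = record
              { isMagma = record
                { isEquivalence = record { refl = ≃-refl ; sym = ≃-sym ; trans = ≃-trans }
                ; ∙-cong = +-cong
                }
              ; assoc = λ x y z → pointwise λ i → ℚ.+-assoc (seq x i) (seq y i) (seq z i)
              }
            ; identity = (λ x → pointwise λ i → ℚ.+-identityˡ (seq x i))
                       , (λ x → pointwise λ i → ℚ.+-identityʳ (seq x i))
            }
          ; inverse = (λ x → pointwise λ i → ℚ.+-inverseˡ (seq x i))
                    , (λ x → pointwise λ i → ℚ.+-inverseʳ (seq x i))
          ; ⁻¹-cong = -‿cong
          }
        ; comm = λ x y → pointwise λ i → ℚ.+-comm (seq x i) (seq y i)
        }
      ; *-cong = *-cong
      ; *-assoc = λ x y z → pointwise λ i → ℚ.*-assoc (seq x i) (seq y i) (seq z i)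
      ; *-identity = (λ x → pointwise λ i → ℚ.*-identityˡ (seq x i))
                   , (λ x → pointwise λ i → ℚ.*-identityʳ (seq x i))
      ; distrib = (λ x y z → pointwise λ i → ℚ.*-distribˡ-+ (seq x i) (seq y i) (seq z i))
                , (λ x y z → pointwise λ i → ℚ.*-distribʳ-+ (seq x i) (seq y i) (seq z i))
      }
    ; *-comm = *-comm
    }
  }

-- Nonnegative reals

pointwise-nonNeg : ∀ x → (∀ i → 0ℚ ℚ.≤ seq x i) → 0ℝ ≤ x
pointwise-nonNeg x 0≤x ε 0<ε = 0 , λ i _ → ℚ.+-mono-≤ (0≤x i) (ℚ.<⇒≤ 0<ε)

nonNeg-resp-≃ : ∀ {x y} → x ≃ y → 0ℝ ≤ x → 0ℝ ≤ y
nonNeg-resp-≃ {x} {y} (≈⇒≃ x≈y) 0≤x ε 0<ε =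
  let N₁ , h₁ = x≈y (ℚ.½ ℚ.* ε) (half-pos 0<ε)
      N₂ , h₂ = 0≤x (ℚ.½ ℚ.* ε) (half-pos 0<ε)
  in N₁ ℕ.⊔ N₂ , λ i N≤i →
    let open ℚ.≤-Reasoning
        d = seq x i ℚ.- seq y i
    in begin
      0ℚ                                        ≤⟨ h₂ i (ℕ.m⊔n≤o⇒n≤o N₁ N₂ N≤i) ⟩
      seq x i ℚ.+ ℚ.½ ℚ.* ε                     ≡⟨ solve 3 (λ a b e → a :+ e := b :+ (a :- b :+ e)) refl
                                                     (seq x i) (seq y i) (ℚ.½ ℚ.* ε) ⟩
      seq y i ℚ.+ (d ℚ.+ ℚ.½ ℚ.* ε)             ≤⟨ ℚ.+-monoʳ-≤ (seq y i) (ℚ.+-monoˡ-≤ (ℚ.½ ℚ.* ε)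
                                                     (ℚ.≤-trans (p≤∣p∣ d) (h₁ i (ℕ.m⊔n≤o⇒m≤o N₁ N₂ N≤i)))) ⟩
      seq y i ℚ.+ (ℚ.½ ℚ.* ε ℚ.+ ℚ.½ ℚ.* ε)     ≡⟨ cong (seq y i ℚ.+_) (halves ε) ⟩
      seq y i ℚ.+ ε                             ∎
  where
  p≤∣p∣ : ∀ p → p ℚ.≤ ℚ.∣ p ∣
  p≤∣p∣ p with ℚ.≤-total 0ℚ p
  ... | inj₁ 0≤p = ℚ.≤-reflexive (sym (ℚ.0≤p⇒∣p∣≡p 0≤p))
  ... | inj₂ p≤0 = ℚ.≤-trans p≤0 (ℚ.0≤∣p∣ p)

-- Replaces a nonnegative real by one whose terms are nonnegative, so that closure
-- under + and * can be checked term by term.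
nonNeg⇒⊔0 : ∀ x → 0ℝ ≤ x → x ≃ x ⊔ 0ℝ
nonNeg⇒⊔0 x 0≤x = ≈⇒≃ λ ε 0<ε → let N , h = 0≤x ε 0<ε in N , λ i N≤i →
  bound (seq x i) ε 0<ε (h i N≤i)
  where
  bound : ∀ p ε → 0ℚ ℚ.< ε → 0ℚ ℚ.≤ p ℚ.+ ε → ℚ.∣ p ℚ.- (p ℚ.⊔ 0ℚ) ∣ ℚ.≤ ε
  bound p ε 0<ε 0≤p+ε with ℚ.≤-total 0ℚ p
  ... | inj₁ 0≤p = subst (λ q → ℚ.∣ q ∣ ℚ.≤ ε)
    (sym (trans (cong (λ q → p ℚ.- q) (ℚ.p≥q⇒p⊔q≡p 0≤p)) (ℚ.+-inverseʳ p))) (ℚ.<⇒≤ 0<ε)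
  -- Here the maximum is 0, so the distance is -p, and the hypothesis 0 ≤ p + ε says that this is at
  -- most ε.
  ... | inj₂ p≤0 = begin
    ℚ.∣ p ℚ.- (p ℚ.⊔ 0ℚ) ∣    ≡⟨ cong (λ q → ℚ.∣ p ℚ.- q ∣) (ℚ.p≤q⇒p⊔q≡q p≤0) ⟩
    ℚ.∣ p ℚ.- 0ℚ ∣            ≡⟨ cong ℚ.∣_∣ (ℚ.+-identityʳ p) ⟩
    ℚ.∣ p ∣                   ≡⟨ ℚ.∣-p∣≡∣p∣ p ⟨
    ℚ.∣ ℚ.- p ∣               ≡⟨ ℚ.0≤p⇒∣p∣≡p (ℚ.neg-antimono-≤ p≤0) ⟩
    ℚ.- p                     ≡⟨ ℚ.+-identityˡ (ℚ.- p) ⟨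
    0ℚ ℚ.- p                  ≤⟨ ℚ.+-monoˡ-≤ (ℚ.- p) 0≤p+ε ⟩
    p ℚ.+ ε ℚ.- p             ≡⟨ solve 2 (λ p e → p :+ e :- p := e) refl p ε ⟩
    ε                         ∎
    where open ℚ.≤-Reasoning

+-nonNeg : ∀ x y → 0ℝ ≤ x → 0ℝ ≤ y → 0ℝ ≤ x + y
+-nonNeg x y 0≤x 0≤y =
  nonNeg-resp-≃ (+-cong (≃-sym (nonNeg⇒⊔0 x 0≤x)) (≃-sym (nonNeg⇒⊔0 y 0≤y)))
    (pointwise-nonNeg ((x ⊔ 0ℝ) + (y ⊔ 0ℝ)) λ i →
      ℚ.+-mono-≤ (ℚ.p≤q⊔p (seq x i) 0ℚ) (ℚ.p≤q⊔p (seq y i) 0ℚ))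

*-nonNegℚ : ∀ {p q} → 0ℚ ℚ.≤ p → 0ℚ ℚ.≤ q → 0ℚ ℚ.≤ p ℚ.* q
*-nonNegℚ {p} {q} 0≤p 0≤q = ℚ.nonNegative⁻¹ (p ℚ.* q)
  {{ℚ.nonNeg*nonNeg⇒nonNeg p {{ℚ.nonNegative 0≤p}} q {{ℚ.nonNegative 0≤q}}}}

*-nonNeg : ∀ x y → 0ℝ ≤ x → 0ℝ ≤ y → 0ℝ ≤ x * y
*-nonNeg x y 0≤x 0≤y =
  nonNeg-resp-≃ (*-cong (≃-sym (nonNeg⇒⊔0 x 0≤x)) (≃-sym (nonNeg⇒⊔0 y 0≤y)))
    (pointwise-nonNeg ((x ⊔ 0ℝ) * (y ⊔ 0ℝ)) λ i →
      *-nonNegℚ (ℚ.p≤q⊔p (seq x i) 0ℚ) (ℚ.p≤q⊔p (seq y i) 0ℚ))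

-- The sign of each rational term is decidable although that of the real is not, so the case split
-- happens inside the sequence.
square-nonNeg : ∀ x → 0ℝ ≤ x * x
square-nonNeg x = pointwise-nonNeg (x * x) λ i → square (seq x i)
  where
  square : ∀ p → 0ℚ ℚ.≤ p ℚ.* p
  square p with ℚ.≤-total 0ℚ p
  ... | inj₁ 0≤p = *-nonNegℚ 0≤p 0≤p
  ... | inj₂ p≤0 = subst (0ℚ ℚ.≤_) (solve 1 (λ p → (:- p) :* (:- p) := p :* p) refl p)
                     (*-nonNegℚ (ℚ.neg-antimono-≤ p≤0) (ℚ.neg-antimono-≤ p≤0))

<⇒nonNeg-diff : ∀ x y → x < y → 0ℝ ≤ y - x
<⇒nonNeg-diff x y (ε , 0<ε , N , h) δ 0<δ = N , λ i N≤i →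
  let open ℚ.≤-Reasoning
      a = seq x i
      b = seq y i
  in begin
    0ℚ               ≡⟨ ℚ.+-inverseʳ a ⟨
    a ℚ.- a          ≤⟨ ℚ.+-monoˡ-≤ (ℚ.- a) (ℚ.≤-trans (p≤p+ a (ℚ.<⇒≤ 0<ε)) (h i N≤i)) ⟩
    b ℚ.- a          ≤⟨ p≤p+ (b ℚ.- a) (ℚ.<⇒≤ 0<δ) ⟩
    b ℚ.- a ℚ.+ δ    ∎
  where
  p≤p+ : ∀ p {q} → 0ℚ ℚ.≤ q → p ℚ.≤ p ℚ.+ q
  p≤p+ p {q} 0≤q = subst (ℚ._≤ p ℚ.+ q) (ℚ.+-identityʳ p) (ℚ.+-monoʳ-≤ p 0≤q)

open CommutativeRing ℝ-commutativeRing
  using (semiring; setoid; zeroˡ; zeroʳ; +-identityʳ; +-identityˡ; *-identityˡ; *-assoc)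
open SemiringSum semiring
  using (∑-comm; ∑-distrib-+; *-distribˡ-sum; *-distribʳ-sum)
  renaming (sum-cong-≋ to ∑-cong; sum-replicate-zero to ∑-zero)

private
  variable
    k l m n p q N : ℕ

module ≃-Reasoning = SetoidReasoning setoid

-- Finite sums

∑-nonNeg : ∀ {n} (f : Vector ℝ n) → (∀ i → 0ℝ ≤ f i) → 0ℝ ≤ ∑ f
∑-nonNeg {zero} f 0≤f = pointwise-nonNeg 0ℝ λ _ → ℚ.≤-refl
∑-nonNeg {suc n} f 0≤f =
  +-nonNeg (f Fin.zero) (∑ (f ∘ Fin.suc)) (0≤f Fin.zero) (∑-nonNeg (f ∘ Fin.suc) (0≤f ∘ Fin.suc))

-- Moves a convexity gap inside a sum, where it can be computed summand by summand.
∑-gap : ∀ {n} (c d : ℝ) (f g h : Vector ℝ n) →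
  (c * ∑ f + d * ∑ g) - ∑ h ≃ ∑ λ i → (c * f i + d * g i) - h i
∑-gap {zero} c d f g h = pointwise λ i →
  solve 2 (λ c d → c :* con 0ℚ :+ d :* con 0ℚ :- con 0ℚ := con 0ℚ) refl (seq c i) (seq d i)
∑-gap {suc n} c d f g h = ≃-trans
  (pointwise λ i →
    solve 8 (λ c d f F g G h H →
      c :* (f :+ F) :+ d :* (g :+ G) :- (h :+ H) :=
      (c :* f :+ d :* g :- h) :+ (c :* F :+ d :* G :- H)) refl
      (seq c i) (seq d i) (seq (f Fin.zero) i) (seq (∑ (f ∘ Fin.suc)) i)
      (seq (g Fin.zero) i) (seq (∑ (g ∘ Fin.suc)) i)
      (seq (h Fin.zero) i) (seq (∑ (h ∘ Fin.suc)) i))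
  (+-cong ≃-refl (∑-gap c d (f ∘ Fin.suc) (g ∘ Fin.suc) (h ∘ Fin.suc)))

∑-splitAt : ∀ m {n} (f : Vector ℝ (m ℕ.+ n)) →
  ∑ f ≃ ∑ (take m f) + ∑ (drop m f)
∑-splitAt zero f = ≃-sym (+-identityˡ (∑ f))
∑-splitAt (suc m) f = ≃-trans
  (+-cong ≃-refl (∑-splitAt m (f ∘ Fin.suc)))
  (pointwise λ i → sym (ℚ.+-assoc (seq (f Fin.zero) i) _ _))

-- At `suc m`, `combine` is by definition `↑ˡ` on the first block and `↑ʳ` on the others, so
-- `∑-splitAt` peels off one block.
∑-combine : ∀ m {n} (f : Vector ℝ (m ℕ.* n)) →
  ∑ f ≃ ∑ λ i → ∑ λ j → f (combine {m} i j)
∑-combine zero f = ≃-refl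
∑-combine (suc m) {n} f = ≃-trans
  (∑-splitAt n f) (+-cong ≃-refl (∑-combine m (drop n f)))

-- The test `suc i ≟ suc j` computes to the test `i ≟ j`, so deleting the first row and column of
-- `1ᴹ` leaves `1ᴹ` definitionally.
∑-1ᴹ : ∀ {n} (j : Fin n) (f : Vector ℝ n) → (∑ λ i → 1ᴹ i j * f i) ≃ f j
∑-1ᴹ {suc n} Fin.zero f = begin
  1ℝ * f Fin.zero + (∑ λ i → 0ℝ * f (Fin.suc i))
    ≈⟨ +-cong (*-identityˡ _) (≃-trans (∑-cong λ i → zeroˡ (f (Fin.suc i))) (∑-zero n)) ⟩
  f Fin.zero + 0ℝ
    ≈⟨ +-identityʳ _ ⟩
  f Fin.zero ∎
  where open ≃-Reasoning
∑-1ᴹ (Fin.suc j) f = begin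
  0ℝ * f Fin.zero + (∑ λ i → 1ᴹ i j * f (Fin.suc i))
    ≈⟨ +-cong (zeroˡ _) (∑-1ᴹ j (f ∘ Fin.suc)) ⟩
  0ℝ + f (Fin.suc j)
    ≈⟨ +-identityˡ _ ⟩
  f (Fin.suc j) ∎
  where open ≃-Reasoning

-- Matrices and congruence

infix 4 _≅_

-- A record for the same reason as `_≃_`: the two matrices can be inferred from it.
record _≅_ (A B : Matrix m n) : Set where
  constructor ≋⇒≅
  field entry : ∀ i j → A i j ≃ B i j

open _≅_ public

≅⇒≋ : {A B : Matrix m n} → A ≅ B → A ≋ B
≅⇒≋ A≅B i j = ≃⇒≈ (entry A≅B i j)

≅-setoid : ℕ → ℕ → Setoid 0ℓ 0ℓ
≅-setoid m n = record
  { Carrier = Matrix m n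
  ; _≈_ = _≅_
  ; isEquivalence = record
    { refl = ≋⇒≅ λ _ _ → ≃-refl
    ; sym = λ A≅B → ≋⇒≅ λ i j → ≃-sym (entry A≅B i j)
    ; trans = λ A≅B B≅C → ≋⇒≅ λ i j → ≃-trans (entry A≅B i j) (entry B≅C i j)
    }
  }

module _ {m n : ℕ} where
  open Setoid (≅-setoid m n) public
    using () renaming (refl to ≅-refl; sym to ≅-sym; trans to ≅-trans)
  module ≅-Reasoning = SetoidReasoning (≅-setoid m n)

ᵀ-cong : {A B : Matrix m n} → A ≅ B → A ᵀ ≅ B ᵀ
ᵀ-cong A≅B = ≋⇒≅ λ i j → entry A≅B j i

+ᴹ-cong : {A B A′ B′ : Matrix m n} → A ≅ A′ → B ≅ B′ → A +ᴹ B ≅ A′ +ᴹ B′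
+ᴹ-cong A≅A′ B≅B′ = ≋⇒≅ λ i j → +-cong (entry A≅A′ i j) (entry B≅B′ i j)

-ᴹ-cong : {A B A′ B′ : Matrix m n} → A ≅ A′ → B ≅ B′ → A -ᴹ B ≅ A′ -ᴹ B′
-ᴹ-cong A≅A′ B≅B′ = ≋⇒≅ λ i j → +-cong (entry A≅A′ i j) (-‿cong (entry B≅B′ i j))

*ᴹ-cong : {A A′ : Matrix m k} {B B′ : Matrix k n} → A ≅ A′ → B ≅ B′ → A *ᴹ B ≅ A′ *ᴹ B′
*ᴹ-cong A≅A′ B≅B′ = ≋⇒≅ λ i j → ∑-cong λ r → *-cong (entry A≅A′ i r) (entry B≅B′ r j)

*ᴹ-assoc : (A : Matrix m k) (B : Matrix k l) (C : Matrix l n) → A *ᴹ B *ᴹ C ≅ A *ᴹ (B *ᴹ C)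
*ᴹ-assoc A B C = ≋⇒≅ λ i j → let open ≃-Reasoning in begin
  (∑ λ s → (∑ λ r → A i r * B r s) * C s j)
    ≈⟨ ∑-cong (λ s → *-distribʳ-sum (C s j) (λ r → A i r * B r s)) ⟩
  (∑ λ s → ∑ λ r → A i r * B r s * C s j)
    ≈⟨ ∑-comm (λ s r → A i r * B r s * C s j) ⟩
  (∑ λ r → ∑ λ s → A i r * B r s * C s j)
    ≈⟨ ∑-cong (λ r → ∑-cong λ s → *-assoc (A i r) (B r s) (C s j)) ⟩
  (∑ λ r → ∑ λ s → A i r * (B r s * C s j))
    ≈⟨ ∑-cong (λ r → *-distribˡ-sum (A i r) (λ s → B r s * C s j)) ⟨
  (∑ λ r → A i r * ∑ λ s → B r s * C s j) ∎

*ᴹ-ᵀ : (A : Matrix m k) (B : Matrix k n) → (A *ᴹ B) ᵀ ≅ B ᵀ *ᴹ A ᵀ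
*ᴹ-ᵀ A B = ≋⇒≅ λ i j → ∑-cong λ r → *-comm (A j r) (B r i)

-- The quadratic terms of `ℬ⁺` and `ℬ⁻` are, by definition, a congruence by `𝑤` of a congruence by
-- `V`.
congruence : Matrix n n → Matrix n m → Matrix m m
congruence A P = P ᵀ *ᴹ A *ᴹ P

congruence-cong : {A B : Matrix n n} {P Q : Matrix n m} → A ≅ B → P ≅ Q →
  congruence A P ≅ congruence B Q
congruence-cong A≅B P≅Q = *ᴹ-cong (*ᴹ-cong (ᵀ-cong P≅Q) A≅B) P≅Q

congruence-ᵀ : (A : Matrix n n) (P : Matrix n m) → congruence A P ᵀ ≅ congruence (A ᵀ) P
congruence-ᵀ A P = begin
  (P ᵀ *ᴹ A *ᴹ P) ᵀ      ≈⟨ *ᴹ-ᵀ (P ᵀ *ᴹ A) P ⟩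
  P ᵀ *ᴹ (P ᵀ *ᴹ A) ᵀ    ≈⟨ *ᴹ-cong ≅-refl (*ᴹ-ᵀ (P ᵀ) A) ⟩
  P ᵀ *ᴹ (A ᵀ *ᴹ P)      ≈⟨ *ᴹ-assoc (P ᵀ) (A ᵀ) P ⟨
  P ᵀ *ᴹ A ᵀ *ᴹ P        ∎
  where open ≅-Reasoning

congruence-congruence : (A : Matrix n n) (P : Matrix n m) (Q : Matrix m k) →
  congruence (congruence A P) Q ≅ congruence A (P *ᴹ Q)
congruence-congruence A P Q = begin
  Q ᵀ *ᴹ (P ᵀ *ᴹ A *ᴹ P) *ᴹ Q      ≈⟨ *ᴹ-assoc (Q ᵀ) (P ᵀ *ᴹ A *ᴹ P) Q ⟩
  Q ᵀ *ᴹ (P ᵀ *ᴹ A *ᴹ P *ᴹ Q)      ≈⟨ *ᴹ-cong ≅-refl (*ᴹ-assoc (P ᵀ *ᴹ A) P Q) ⟩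
  Q ᵀ *ᴹ (P ᵀ *ᴹ A *ᴹ (P *ᴹ Q))    ≈⟨ *ᴹ-assoc (Q ᵀ) (P ᵀ *ᴹ A) (P *ᴹ Q) ⟨
  Q ᵀ *ᴹ (P ᵀ *ᴹ A) *ᴹ (P *ᴹ Q)    ≈⟨ *ᴹ-cong (*ᴹ-assoc (Q ᵀ) (P ᵀ) A) ≅-refl ⟨
  Q ᵀ *ᴹ P ᵀ *ᴹ A *ᴹ (P *ᴹ Q)      ≈⟨ *ᴹ-cong (*ᴹ-cong (*ᴹ-ᵀ P Q) (≅-refl {x = A})) (≅-refl {x = P *ᴹ Q}) ⟨
  (P *ᴹ Q) ᵀ *ᴹ A *ᴹ (P *ᴹ Q)      ∎
  where open ≅-Reasoning

-- Summed in the order of `IsPSD`, so that `bilinear A v v` is definitionally the quadratic form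
-- tested there.
bilinear : Matrix n n → Vector ℝ n → Vector ℝ n → ℝ
bilinear A u v = ∑ λ i → ∑ λ j → u i * A i j * v j

bilinear-cong : {A B : Matrix n n} → A ≅ B → ∀ u v → bilinear A u v ≃ bilinear B u v
bilinear-cong A≅B u v =
  ∑-cong λ i → ∑-cong λ j → *-cong (*-congˡ (u i) (entry A≅B i j)) ≃-refl

bilinear-+ᴹ : (A B : Matrix n n) → ∀ u v →
  bilinear (A +ᴹ B) u v ≃ bilinear A u v + bilinear B u v
bilinear-+ᴹ A B u v = begin
  bilinear (A +ᴹ B) u v
    ≈⟨ ∑-cong (λ i → ∑-cong λ j → pointwise λ t →
         solve 4 (λ x a b y → x :* (a :+ b) :* y := x :* a :* y :+ x :* b :* y) refl
           (seq (u i) t) (seq (A i j) t) (seq (B i j) t) (seq (v j) t)) ⟩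
  (∑ λ i → ∑ λ j → u i * A i j * v j + u i * B i j * v j)
    ≈⟨ ∑-cong (λ i → ∑-distrib-+ (λ j → u i * A i j * v j) (λ j → u i * B i j * v j)) ⟩
  (∑ λ i → (∑ λ j → u i * A i j * v j) + (∑ λ j → u i * B i j * v j))
    ≈⟨ ∑-distrib-+ (λ i → ∑ λ j → u i * A i j * v j) (λ i → ∑ λ j → u i * B i j * v j) ⟩
  bilinear A u v + bilinear B u v ∎
  where open ≃-Reasoning

bilinear-·ᴹ : ∀ c (A : Matrix n n) u v → bilinear (c ·ᴹ A) u v ≃ c * bilinear A u v
bilinear-·ᴹ c A u v = begin
  bilinear (c ·ᴹ A) u v
    ≈⟨ ∑-cong (λ i → ∑-cong λ j → pointwise λ t →
         solve 4 (λ c x a y → x :* (c :* a) :* y := c :* (x :* a :* y)) refl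
           (seq c t) (seq (u i) t) (seq (A i j) t) (seq (v j) t)) ⟩
  (∑ λ i → ∑ λ j → c * (u i * A i j * v j))
    ≈⟨ ∑-cong (λ i → *-distribˡ-sum c (λ j → u i * A i j * v j)) ⟨
  (∑ λ i → c * ∑ λ j → u i * A i j * v j)
    ≈⟨ *-distribˡ-sum c (λ i → ∑ λ j → u i * A i j * v j) ⟨
  c * bilinear A u v ∎
  where open ≃-Reasoning

-- An entry of PᵀAP pairs two columns of P under A. After exchanging the sums, matrix identities
-- become identities between the summands of a double sum.
congruence-entry : (A : Matrix n n) (P : Matrix n m) → ∀ i j →
  congruence A P i j ≃ bilinear A ((P ᵀ) i) ((P ᵀ) j)
congruence-entry A P i j = begin
  (∑ λ s → (∑ λ r → P r i * A r s) * P s j)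
    ≈⟨ ∑-cong (λ s → *-distribʳ-sum (P s j) (λ r → P r i * A r s)) ⟩
  (∑ λ s → ∑ λ r → P r i * A r s * P s j)
    ≈⟨ ∑-comm (λ s r → P r i * A r s * P s j) ⟩
  bilinear A ((P ᵀ) i) ((P ᵀ) j) ∎
  where open ≃-Reasoning

congruence-+ᴹ : (A B : Matrix n n) (P : Matrix n m) →
  congruence (A +ᴹ B) P ≅ congruence A P +ᴹ congruence B P
congruence-+ᴹ A B P = ≋⇒≅ λ i j → let open ≃-Reasoning in begin
  congruence (A +ᴹ B) P i j
    ≈⟨ congruence-entry (A +ᴹ B) P i j ⟩
  bilinear (A +ᴹ B) ((P ᵀ) i) ((P ᵀ) j)
    ≈⟨ bilinear-+ᴹ A B ((P ᵀ) i) ((P ᵀ) j) ⟩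
  bilinear A ((P ᵀ) i) ((P ᵀ) j) + bilinear B ((P ᵀ) i) ((P ᵀ) j)
    ≈⟨ +-cong (congruence-entry A P i j) (congruence-entry B P i j) ⟨
  congruence A P i j + congruence B P i j ∎

∑∑-gap : ∀ (c d : ℝ) (f g h : Fin m → Fin n → ℝ) →
  (c * (∑ λ r → ∑ λ s → f r s) + d * (∑ λ r → ∑ λ s → g r s)) - (∑ λ r → ∑ λ s → h r s)
    ≃ ∑ λ r → ∑ λ s → (c * f r s + d * g r s) - h r s
∑∑-gap c d f g h = ≃-trans
  (∑-gap c d (λ r → ∑ (f r)) (λ r → ∑ (g r)) (λ r → ∑ (h r)))
  (∑-cong λ r → ∑-gap c d (f r) (g r) (h r))

congruence-gap : (A : Matrix n n) (P Q : Matrix n m) (μ : ℝ) →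
  μ ·ᴹ congruence A P +ᴹ (1ℝ - μ) ·ᴹ congruence A Q
    -ᴹ congruence A (μ ·ᴹ P +ᴹ (1ℝ - μ) ·ᴹ Q)
  ≅ (μ * (1ℝ - μ)) ·ᴹ congruence A (P -ᴹ Q)
congruence-gap A P Q μ = ≋⇒≅ λ i j → let open ≃-Reasoning in begin
  (μ * congruence A P i j + ν * congruence A Q i j) - congruence A R i j
    ≈⟨ +-cong (+-cong (*-congˡ μ (congruence-entry A P i j)) (*-congˡ ν (congruence-entry A Q i j)))
              (-‿cong (congruence-entry A R i j)) ⟩
  (μ * (∑ λ r → ∑ λ s → term P i j r s) + ν * (∑ λ r → ∑ λ s → term Q i j r s))
    - (∑ λ r → ∑ λ s → term R i j r s)
    ≈⟨ ∑∑-gap μ ν (term P i j) (term Q i j) (term R i j) ⟩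
  (∑ λ r → ∑ λ s → (μ * term P i j r s + ν * term Q i j r s) - term R i j r s)
    ≈⟨ ∑-cong (λ r → ∑-cong λ s → pointwise λ t → identity (seq μ t) (seq (A r s) t)
         (seq (P r i) t) (seq (Q r i) t) (seq (P s j) t) (seq (Q s j) t)) ⟩
  (∑ λ r → ∑ λ s → (μ * ν) * term (P -ᴹ Q) i j r s)
    ≈⟨ ∑-cong (λ r → *-distribˡ-sum (μ * ν) (term (P -ᴹ Q) i j r)) ⟨
  (∑ λ r → (μ * ν) * ∑ λ s → term (P -ᴹ Q) i j r s)
    ≈⟨ *-distribˡ-sum (μ * ν) (λ r → ∑ λ s → term (P -ᴹ Q) i j r s) ⟨
  (μ * ν) * (∑ λ r → ∑ λ s → term (P -ᴹ Q) i j r s)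
    ≈⟨ *-congˡ (μ * ν) (congruence-entry A (P -ᴹ Q) i j) ⟨
  (μ * ν) * congruence A (P -ᴹ Q) i j ∎
  where
  ν = 1ℝ - μ
  R = μ ·ᴹ P +ᴹ ν ·ᴹ Q

  term : Matrix _ _ → ∀ i j r s → ℝ
  term X i j r s = X r i * A r s * X s j

  -- With ν = 1 - μ, the products xau and yav have coefficients μ - μ² and ν - ν², both equal to μν,
  -- and the cross products have -μν.
  identity : ∀ μ a x y u v → let ν = 1ℚ ℚ.- μ in
    μ ℚ.* (x ℚ.* a ℚ.* u) ℚ.+ ν ℚ.* (y ℚ.* a ℚ.* v)
      ℚ.- (μ ℚ.* x ℚ.+ ν ℚ.* y) ℚ.* a ℚ.* (μ ℚ.* u ℚ.+ ν ℚ.* v)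
    ≡ μ ℚ.* ν ℚ.* ((x ℚ.- y) ℚ.* a ℚ.* (u ℚ.- v))
  identity = solve 6 (λ μ a x y u v → let ν = con 1ℚ :- μ in
    μ :* (x :* a :* u) :+ ν :* (y :* a :* v)
      :- (μ :* x :+ ν :* y) :* a :* (μ :* u :+ ν :* v)
    := μ :* ν :* ((x :- y) :* a :* (u :- v))) refl

symmetric≅ : {A : Matrix n n} → IsSymmetric A → A ≅ A ᵀ
symmetric≅ A-sym = ≋⇒≅ λ i j → ≈⇒≃ (A-sym i j)

-- Positive semidefiniteness and convexity

PSD-resp-≅ : {A B : Matrix n n} → A ≅ B → IsPSD A → IsPSD B
PSD-resp-≅ {A = A} {B} A≅B (A-sym , 0≤A) =
  ≅⇒≋ (≅-trans (≅-sym A≅B) (≅-trans (symmetric≅ A-sym) (ᵀ-cong A≅B))) ,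
  λ v → nonNeg-resp-≃ (bilinear-cong A≅B v v) (0≤A v)

-- vᵀ(PᵀAP)v = (Pv)ᵀA(Pv). With `v` as a one-column matrix this is an instance of
-- `congruence-congruence`, read at its only entry.
PSD-congruence : (A : Matrix n n) (P : Matrix n m) → IsPSD A → IsPSD (congruence A P)
PSD-congruence A P (A-sym , 0≤A) =
  ≅⇒≋ (≅-trans (congruence-cong (symmetric≅ A-sym) (≅-refl {x = P})) (≅-sym (congruence-ᵀ A P))) ,
  λ v → nonNeg-resp-≃ (bilinear-congruence v) (0≤A (((P *ᴹ column v) ᵀ) Fin.zero))
  where
  open ≃-Reasoning
  bilinear-congruence : ∀ v →
    bilinear A (((P *ᴹ column v) ᵀ) Fin.zero) (((P *ᴹ column v) ᵀ) Fin.zero)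
      ≃ bilinear (congruence A P) v v
  bilinear-congruence v = begin
    bilinear A (((P *ᴹ column v) ᵀ) Fin.zero) (((P *ᴹ column v) ᵀ) Fin.zero)
      ≈⟨ congruence-entry A (P *ᴹ column v) Fin.zero Fin.zero ⟨
    congruence A (P *ᴹ column v) Fin.zero Fin.zero
      ≈⟨ entry (congruence-congruence A P (column v)) Fin.zero Fin.zero ⟨
    congruence (congruence A P) (column v) Fin.zero Fin.zero
      ≈⟨ congruence-entry (congruence A P) (column v) Fin.zero Fin.zero ⟩
    bilinear (congruence A P) v v ∎

PSD-0ᴹ : IsPSD (0ᴹ {n} {n})
PSD-0ᴹ {n} = ≅⇒≋ {A = 0ᴹ} {0ᴹ} ≅-refl , λ v →
  ∑-nonNeg (λ i → ∑ λ j → v i * 0ℝ * v j) λ i → ∑-nonNeg (λ j → v i * 0ℝ * v j) λ j →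
    pointwise-nonNeg (v i * 0ℝ * v j) λ t → ℚ.≤-reflexive
      (solve 2 (λ x y → con 0ℚ := x :* con 0ℚ :* y) refl (seq (v i) t) (seq (v j) t))

PSD-+ᴹ : (A B : Matrix n n) → IsPSD A → IsPSD B → IsPSD (A +ᴹ B)
PSD-+ᴹ A B (A-sym , 0≤A) (B-sym , 0≤B) =
  ≅⇒≋ (+ᴹ-cong (symmetric≅ {A = A} A-sym) (symmetric≅ {A = B} B-sym)) ,
  λ v → nonNeg-resp-≃ (≃-sym (bilinear-+ᴹ A B v v))
    (+-nonNeg (bilinear A v v) (bilinear B v v) (0≤A v) (0≤B v))

PSD-·ᴹ : ∀ c (A : Matrix n n) → 0ℝ ≤ c → IsPSD A → IsPSD (c ·ᴹ A)
PSD-·ᴹ c A 0≤c (A-sym , 0≤A) =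
  ≅⇒≋ (≋⇒≅ λ i j → *-congˡ c (entry (symmetric≅ {A = A} A-sym) i j)) ,
  λ v → nonNeg-resp-≃ (≃-sym (bilinear-·ᴹ c A v v)) (*-nonNeg c (bilinear A v v) 0≤c (0≤A v))

-- The double sum is not collapsed to its diagonal: each summand is nonnegative by itself, being d
-- times a square on the diagonal and equal to 0 off it.
PSD-diagonal : (D : Matrix n n) → IsDiagonal D → (∀ i → 0ℝ ≤ D i i) → IsPSD D
PSD-diagonal D D-diagonal 0≤D =
  ≅⇒≋ (≋⇒≅ symmetric) , λ v →
    ∑-nonNeg (λ i → ∑ λ j → v i * D i j * v j) λ i →
    ∑-nonNeg (λ j → v i * D i j * v j) λ j → term v i j
  where
  off-diagonal : ∀ {i j} → i ≢ j → D i j ≃ 0ℝ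
  off-diagonal i≢j = ≈⇒≃ (D-diagonal _ _ i≢j)

  symmetric : ∀ i j → D i j ≃ D j i
  symmetric i j with i Fin.≟ j
  ... | yes refl = ≃-refl
  ... | no i≢j = ≃-trans (off-diagonal i≢j) (≃-sym (off-diagonal (i≢j ∘ sym)))

  term : ∀ v i j → 0ℝ ≤ v i * D i j * v j
  term v i j with i Fin.≟ j
  ... | yes refl = nonNeg-resp-≃
    {D i i * (v i * v i)} {v i * D i i * v i} (pointwise λ t → solve 2 (λ d x → d :* (x :* x) := x :* d :* x) refl
      (seq (D i i) t) (seq (v i) t))
    (*-nonNeg (D i i) (v i * v i) (0≤D i) (square-nonNeg (v i)))
  ... | no i≢j = nonNeg-resp-≃ {0ℝ} {v i * D i j * v j}
    (≃-trans
      (pointwise {y = v i * 0ℝ * v j} λ t →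
        solve 2 (λ x y → con 0ℚ := x :* con 0ℚ :* y) refl (seq (v i) t) (seq (v j) t))
      (*-cong (*-congˡ (v i) (≃-sym (off-diagonal i≢j))) ≃-refl))
    (pointwise-nonNeg 0ℝ λ _ → ℚ.≤-refl)

IsAffine : (Vector ℝ N → Matrix k l) → Set
IsAffine W = ∀ z₁ z₂ μ →
  W (μ ·ᵛ z₁ +ᵛ (1ℝ - μ) ·ᵛ z₂) ≅ μ ·ᴹ W z₁ +ᴹ (1ℝ - μ) ·ᴹ W z₂

private
  convex-combination-constant : ∀ μ x → x ≃ μ * x + (1ℝ - μ) * x
  convex-combination-constant μ x = pointwise λ t →
    solve 2 (λ μ x → x := μ :* x :+ (con 1ℚ :- μ) :* x) refl (seq μ t) (seq x t)

affine-const : (A : Matrix k l) → IsAffine {N} (λ _ → A)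
affine-const A _ _ μ = ≋⇒≅ λ i j → convex-combination-constant μ (A i j)

affine-*ᴹ : (A : Matrix k l) (W : Vector ℝ N → Matrix l n) →
  IsAffine W → IsAffine (λ z → A *ᴹ W z)
affine-*ᴹ A W W-affine z₁ z₂ μ = ≋⇒≅ λ i j → let open ≃-Reasoning in begin
  (∑ λ r → A i r * W (μ ·ᵛ z₁ +ᵛ ν ·ᵛ z₂) r j)
    ≈⟨ ∑-cong (λ r → *-congˡ (A i r) (entry (W-affine z₁ z₂ μ) r j)) ⟩
  (∑ λ r → A i r * (μ * W z₁ r j + ν * W z₂ r j))
    ≈⟨ ∑-cong (λ r → pointwise λ t →
         solve 5 (λ a m n x y → a :* (m :* x :+ n :* y) := m :* (a :* x) :+ n :* (a :* y)) refl
           (seq (A i r) t) (seq μ t) (seq ν t) (seq (W z₁ r j) t) (seq (W z₂ r j) t)) ⟩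
  (∑ λ r → μ * (A i r * W z₁ r j) + ν * (A i r * W z₂ r j))
    ≈⟨ ∑-distrib-+ (λ r → μ * (A i r * W z₁ r j)) (λ r → ν * (A i r * W z₂ r j)) ⟩
  (∑ λ r → μ * (A i r * W z₁ r j)) + (∑ λ r → ν * (A i r * W z₂ r j))
    ≈⟨ +-cong (*-distribˡ-sum μ (λ r → A i r * W z₁ r j)) (*-distribˡ-sum ν (λ r → A i r * W z₂ r j)) ⟨
  μ * (A *ᴹ W z₁) i j + ν * (A *ᴹ W z₂) i j ∎
  where
  ν = 1ℝ - μ

affine-⊗ᶜ : (A : Matrix p q) → IsAffine {m} (λ x → x ⊗ᶜ A)
affine-⊗ᶜ {p} {q} {m} A x₁ x₂ μ = ≋⇒≅ λ r b → pointwise λ t →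
  solve 5 (λ μ ν x y a → (μ :* x :+ ν :* y) :* a := μ :* (x :* a) :+ ν :* (y :* a)) refl
    (seq μ t) (seq (1ℝ - μ) t) (seq (x₁ (quotient p r)) t) (seq (x₂ (quotient p r)) t)
    (seq (A (remainder {m} p r) (remainder {1} q (combine {1} Fin.zero b))) t)

affine-𝑤 : ∀ m n p → IsAffine (λ z → 𝑤 {m} {n} {p} (take m z) (drop m z))
affine-𝑤 m n p z₁ z₂ μ = ≋⇒≅ affine
  where
  𝐰 : Vector ℝ (m ℕ.+ n) → Matrix (m ℕ.* p ℕ.+ n ℕ.* p) p
  𝐰 z = 𝑤 (take m z) (drop m z)

  affine : ∀ s b → 𝐰 (μ ·ᵛ z₁ +ᵛ (1ℝ - μ) ·ᵛ z₂) s b ≃ μ * 𝐰 z₁ s b + (1ℝ - μ) * 𝐰 z₂ s b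
  -- `_++_` branches on `splitAt`, so one case split reduces all three occurrences of `𝐰` to the
  -- same block.
  affine s b with splitAt (m ℕ.* p) s
  ... | inj₁ r = entry (affine-⊗ᶜ 1ᴹ (take m z₁) (take m z₂) μ) r b
  ... | inj₂ r = entry (affine-⊗ᶜ 1ᴹ (drop m z₁) (drop m z₂) μ) r b

-- The convexity gap of an affine map is the zero matrix.
PSDConvex-affine : (L : Vector ℝ N → Matrix p p) →
  (∀ z → IsSymmetric (L z)) → IsAffine L → PSDConvexOn U L
PSDConvex-affine L L-sym L-affine = record
  { domainConvex = λ _ _ _ _ _ _ _ → tt
  ; symmetricValued = L-sym
  ; convex = λ z₁ z₂ _ _ μ _ _ → PSD-resp-≅
      (≋⇒≅ λ i j → ≃-trans
        (≃-sym (pointwise λ t → ℚ.+-inverseʳ (seq (L (μ ·ᵛ z₁ +ᵛ (1ℝ - μ) ·ᵛ z₂) i j) t)))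
        (+-cong (entry (L-affine z₁ z₂ μ) i j) ≃-refl))
      PSD-0ᴹ
  }

-- The gap of a sum is the sum of the gaps.
PSDConvex-+ᴹ : (B C : Vector ℝ N → Matrix p p) →
  PSDConvexOn U B → PSDConvexOn U C → PSDConvexOn U (λ z → B z +ᴹ C z)
PSDConvex-+ᴹ B C B-convex C-convex = record
  { domainConvex = λ _ _ _ _ _ _ _ → tt
  ; symmetricValued = λ z → ≅⇒≋ (+ᴹ-cong
      (symmetric≅ {A = B z} (PSDConvexOn.symmetricValued B-convex z))
      (symmetric≅ {A = C z} (PSDConvexOn.symmetricValued C-convex z)))
  ; convex = λ z₁ z₂ _ _ μ 0<μ μ<1 →
      let z = μ ·ᵛ z₁ +ᵛ (1ℝ - μ) ·ᵛ z₂ in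
      PSD-resp-≅
        (≋⇒≅ λ i j → pointwise λ t →
          solve 8 (λ m n b₁ b₂ b c₁ c₂ c →
            (m :* b₁ :+ n :* b₂ :- b) :+ (m :* c₁ :+ n :* c₂ :- c) :=
            m :* (b₁ :+ c₁) :+ n :* (b₂ :+ c₂) :- (b :+ c)) refl
            (seq μ t) (seq (1ℝ - μ) t)
            (seq (B z₁ i j) t) (seq (B z₂ i j) t) (seq (B z i j) t)
            (seq (C z₁ i j) t) (seq (C z₂ i j) t) (seq (C z i j) t))
        (PSD-+ᴹ (μ ·ᴹ B z₁ +ᴹ (1ℝ - μ) ·ᴹ B z₂ -ᴹ B z) (μ ·ᴹ C z₁ +ᴹ (1ℝ - μ) ·ᴹ C z₂ -ᴹ C z)
          (PSDConvexOn.convex B-convex z₁ z₂ tt tt μ 0<μ μ<1)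
          (PSDConvexOn.convex C-convex z₁ z₂ tt tt μ 0<μ μ<1))
  }

PSDConvex-congruence : (A : Matrix n n) (W : Vector ℝ N → Matrix n p) →
  IsPSD A → IsAffine W → PSDConvexOn U (λ z → congruence A (W z))
PSDConvex-congruence A W A-psd W-affine = record
  { domainConvex = λ _ _ _ _ _ _ _ → tt
  ; symmetricValued = λ z → proj₁ (PSD-congruence A (W z) A-psd)
  ; convex = λ z₁ z₂ _ _ μ 0<μ μ<1 →
      PSD-resp-≅
        (≅-trans (≅-sym (congruence-gap A (W z₁) (W z₂) μ))
          (-ᴹ-cong ≅-refl (congruence-cong (≅-refl {x = A}) (≅-sym (W-affine z₁ z₂ μ)))))
        (PSD-·ᴹ (μ * (1ℝ - μ)) (congruence A (W z₁ -ᴹ W z₂))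
          (*-nonNeg μ (1ℝ - μ)
            (nonNeg-resp-≃ {μ - 0ℝ} {μ} (pointwise λ t → ℚ.+-identityʳ (seq μ t))
              (<⇒nonNeg-diff 0ℝ μ 0<μ))
            (<⇒nonNeg-diff μ 1ℝ μ<1))
          (PSD-congruence A (W z₁ -ᴹ W z₂) A-psd))
  }

-- The block matrices of the theorem

⊗ᶜ-combine : (x : Vector ℝ m) (A : Matrix p q) → ∀ i j b →
  (x ⊗ᶜ A) (combine i j) b ≡ x i * A j b
⊗ᶜ-combine {p = p} {q} x A i j b = cong₂ (λ ij b′ → x (proj₁ ij) * A (proj₂ ij) b′)
  -- The first equation decodes the row index; the second undoes the reindexing of the 1 * q columns
  -- built into `_⊗ᶜ_`.
  (Fin.remQuot-combine {k = p} i j) (cong proj₂ (Fin.remQuot-combine {1} {q} Fin.zero b))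

blocks-combine : (A : Fin m → Fin n → Matrix p q) → ∀ i a j b →
  blocks A (combine i a) (combine j b) ≡ A i j a b
blocks-combine {p = p} {q} A i a j b =
  cong₂ (λ ia jb → A (proj₁ ia) (proj₁ jb) (proj₂ ia) (proj₂ jb))
    (Fin.remQuot-combine {k = p} i a) (Fin.remQuot-combine {k = q} j b)

blockRow-combine : (A : Vector (Matrix p q) n) → ∀ a j b →
  blockRow A a (combine j b) ≡ A j a b
blockRow-combine {q = q} A a j b =
  cong (λ jb → A (proj₁ jb) a (proj₂ jb)) (Fin.remQuot-combine {k = q} j b)

-- Column `b` of x ⊗ I vanishes outside the rows `combine i b`, where it equals `x i`.
∑-⊗ᶜ : ∀ (x : Vector ℝ m) (b : Fin p) (f : Vector ℝ (m ℕ.* p)) →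
  (∑ λ s → (x ⊗ᶜ 1ᴹ) s b * f s) ≃ ∑ λ i → x i * f (combine i b)
∑-⊗ᶜ {m} {p} x b f = begin
  (∑ λ s → (x ⊗ᶜ 1ᴹ) s b * f s)
    ≈⟨ ∑-combine m {p} (λ s → (x ⊗ᶜ 1ᴹ) s b * f s) ⟩
  (∑ λ i → ∑ λ k → (x ⊗ᶜ 1ᴹ) (combine {m} {p} i k) b * f (combine i k))
    ≈⟨ ∑-cong (λ i → ∑-cong λ k → ≃-trans
         (*-cong (≡⇒≃ (⊗ᶜ-combine x 1ᴹ i k b)) ≃-refl)
         (*-assoc (x i) (1ᴹ k b) (f (combine i k)))) ⟩
  (∑ λ i → ∑ λ k → x i * (1ᴹ k b * f (combine i k)))
    ≈⟨ ∑-cong (λ i → *-distribˡ-sum (x i) (λ k → 1ᴹ k b * f (combine i k))) ⟨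
  (∑ λ i → x i * ∑ λ k → 1ᴹ k b * f (combine i k))
    ≈⟨ ∑-cong (λ i → *-congˡ (x i) (∑-1ᴹ b (λ k → f (combine i k)))) ⟩
  (∑ λ i → x i * f (combine i b)) ∎
  where open ≃-Reasoning

-- How a column of `𝑤` pairs with an arbitrary vector. The linear term needs it once; the bilinear
-- term needs it on each side of `𝑀`.
∑-𝑤 : ∀ (x : Vector ℝ m) (y : Vector ℝ n) (b : Fin p) (f : Vector ℝ (m ℕ.* p ℕ.+ n ℕ.* p)) →
  (∑ λ s → 𝑤 x y s b * f s) ≃
    (∑ λ i → x i * f (combine i b ↑ˡ n ℕ.* p)) + (∑ λ j → y j * f (m ℕ.* p ↑ʳ combine j b))
∑-𝑤 {m} {n} {p} x y b f = begin
  (∑ λ s → 𝑤 x y s b * f s)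
    ≈⟨ ∑-splitAt (m ℕ.* p) (λ s → 𝑤 x y s b * f s) ⟩
  (∑ λ r → 𝑤 x y (r ↑ˡ n ℕ.* p) b * f (r ↑ˡ n ℕ.* p)) +
  (∑ λ r → 𝑤 x y (m ℕ.* p ↑ʳ r) b * f (m ℕ.* p ↑ʳ r))
    ≈⟨ +-cong
         (∑-cong λ r → *-cong (≡⇒≃ (cong-app (lookup-++ˡ (x ⊗ᶜ 1ᴹ) (y ⊗ᶜ 1ᴹ) r) b)) ≃-refl)
         (∑-cong λ r → *-cong (≡⇒≃ (cong-app (lookup-++ʳ (x ⊗ᶜ 1ᴹ) (y ⊗ᶜ 1ᴹ) r) b)) ≃-refl) ⟩
  (∑ λ r → (x ⊗ᶜ 1ᴹ) r b * f (r ↑ˡ n ℕ.* p)) + (∑ λ r → (y ⊗ᶜ 1ᴹ) r b * f (m ℕ.* p ↑ʳ r))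
    ≈⟨ +-cong (∑-⊗ᶜ x b (λ r → f (r ↑ˡ n ℕ.* p))) (∑-⊗ᶜ y b (λ r → f (m ℕ.* p ↑ʳ r))) ⟩
  (∑ λ i → x i * f (combine i b ↑ˡ n ℕ.* p)) + (∑ λ j → y j * f (m ℕ.* p ↑ʳ combine j b)) ∎
  where open ≃-Reasoning

Ω-𝑤 : (H : Vector (Matrix p p) m) (G : Vector (Matrix p p) n) → ∀ x y →
  (blockRow H ∥ blockRow G) *ᴹ 𝑤 x y ≅ ∑ᴹ (λ i → x i ·ᴹ H i) +ᴹ ∑ᴹ (λ j → y j ·ᴹ G j)
Ω-𝑤 {p} {m} {n} H G x y = ≋⇒≅ λ a b → let open ≃-Reasoning in begin
  (∑ λ s → Ω a s * 𝑤 x y s b)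
    ≈⟨ ∑-cong (λ s → *-comm (Ω a s) (𝑤 x y s b)) ⟩
  (∑ λ s → 𝑤 x y s b * Ω a s)
    ≈⟨ ∑-𝑤 x y b (Ω a) ⟩
  (∑ λ i → x i * Ω a (combine i b ↑ˡ n ℕ.* p)) + (∑ λ j → y j * Ω a (m ℕ.* p ↑ʳ combine j b))
    ≈⟨ +-cong
         (∑-cong λ i → *-congˡ (x i) (≡⇒≃ (trans
           (lookup-++ˡ (blockRow H a) (blockRow G a) (combine i b)) (blockRow-combine H a i b))))
         (∑-cong λ j → *-congˡ (y j) (≡⇒≃ (trans
           (lookup-++ʳ (blockRow H a) (blockRow G a) (combine j b)) (blockRow-combine G a j b)))) ⟩
  (∑ λ i → x i * H i a b) + (∑ λ j → y j * G j a b) ∎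
  where
  Ω = blockRow H ∥ blockRow G

𝑀-𝑤 : (E : Fin m → Fin n → Matrix p p) → (∀ i j → IsSymmetric (E i j)) → ∀ x y →
  congruence (𝑀 E) (𝑤 x y) ≅ ∑ᴹ λ i → ∑ᴹ λ j → (x i * y j) ·ᴹ E i j
𝑀-𝑤 {m} {n} {p} E E-sym x y = ≋⇒≅ 𝑀-𝑤-entry
  where
  open ≃-Reasoning
  inˡ : Fin m → Fin p → Fin (m ℕ.* p ℕ.+ n ℕ.* p)
  inˡ i a = combine i a ↑ˡ n ℕ.* p

  inʳ : Fin n → Fin p → Fin (m ℕ.* p ℕ.+ n ℕ.* p)
  inʳ j b = m ℕ.* p ↑ʳ combine j b

  top : ∀ r → 𝑀 E (r ↑ˡ n ℕ.* p) ≡ (0ᴹ ∥ Γ E) r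
  top = lookup-++ˡ (0ᴹ ∥ Γ E) (Γ E ᵀ ∥ 0ᴹ)

  bottom : ∀ r → 𝑀 E (m ℕ.* p ↑ʳ r) ≡ (Γ E ᵀ ∥ 0ᴹ) r
  bottom = lookup-++ʳ (0ᴹ ∥ Γ E) (Γ E ᵀ ∥ 0ᴹ)

  𝑀ˡˡ : ∀ i a i′ b → 𝑀 E (inˡ i a) (inˡ i′ b) ≡ 0ℝ
  𝑀ˡˡ i a i′ b = trans (cong-app (top (combine i a)) (inˡ i′ b))
    (lookup-++ˡ (0ᴹ (combine i a)) (Γ E (combine i a)) (combine i′ b))

  𝑀ˡʳ : ∀ i a j b → 𝑀 E (inˡ i a) (inʳ j b) ≡ ½ℝ * E i j a b
  𝑀ˡʳ i a j b = trans (cong-app (top (combine i a)) (inʳ j b))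
    (trans (lookup-++ʳ {m = m ℕ.* p} (0ᴹ (combine i a)) (Γ E (combine i a)) (combine {n} {p} j b))
      (blocks-combine (λ i j → ½ℝ ·ᴹ E i j) i a j b))

  -- Transposing Γ also transposes each p × p block, hence the order `b a`; the symmetry of `E i j`
  -- restores `a b` in `columnˡ`.
  𝑀ʳˡ : ∀ j a i b → 𝑀 E (inʳ j a) (inˡ i b) ≡ ½ℝ * E i j b a
  𝑀ʳˡ j a i b = trans (cong-app (bottom (combine j a)) (inˡ i b))
    (trans (lookup-++ˡ ((Γ E ᵀ) (combine j a)) (0ᴹ (combine j a)) (combine i b))
      (blocks-combine (λ i j → ½ℝ ·ᴹ E i j) i b j a))

  𝑀ʳʳ : ∀ j a j′ b → 𝑀 E (inʳ j a) (inʳ j′ b) ≡ 0ℝ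
  𝑀ʳʳ j a j′ b = trans (cong-app (bottom (combine j a)) (inʳ j′ b))
    (lookup-++ʳ ((Γ E ᵀ) (combine j a)) (0ᴹ (combine j a)) (combine j′ b))

  ∑-vanish : ∀ {k} (u f : Vector ℝ k) → (∀ i → f i ≡ 0ℝ) → (∑ λ i → u i * f i) ≃ 0ℝ
  ∑-vanish {k} u f f≡0 = ≃-trans
    (∑-cong λ i → ≃-trans (*-congˡ (u i) (≡⇒≃ (f≡0 i))) (zeroʳ (u i))) (∑-zero k)

  half : Fin p → Fin p → Fin m → Fin n → ℝ
  half a b i j = ½ℝ * (x i * y j * E i j a b)

  -- A column of `𝑀` through its left blocks meets 0 above and Γᵀ below, so only the `y` part of `𝑤`
  -- survives.
  columnˡ : ∀ a i b →
    x i * (∑ λ r → 𝑤 x y r a * 𝑀 E r (inˡ i b)) ≃ ∑ λ j → half a b i j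
  columnˡ a i b = begin
    x i * (∑ λ r → 𝑤 x y r a * 𝑀 E r (inˡ i b))
      ≈⟨ *-congˡ (x i) (∑-𝑤 x y a (λ r → 𝑀 E r (inˡ i b))) ⟩
    x i * ((∑ λ i′ → x i′ * 𝑀 E (inˡ i′ a) (inˡ i b)) + (∑ λ j → y j * 𝑀 E (inʳ j a) (inˡ i b)))
      ≈⟨ *-congˡ (x i) (+-cong
           (∑-vanish x (λ i′ → 𝑀 E (inˡ i′ a) (inˡ i b)) (λ i′ → 𝑀ˡˡ i′ a i b))
           (∑-cong λ j → *-congˡ (y j) (≃-trans (≡⇒≃ (𝑀ʳˡ j a i b))
             (*-congˡ ½ℝ (≈⇒≃ (E-sym i j b a)))))) ⟩
    x i * (0ℝ + (∑ λ j → y j * (½ℝ * E i j a b)))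
      ≈⟨ *-congˡ (x i) (+-identityˡ _) ⟩
    x i * (∑ λ j → y j * (½ℝ * E i j a b))
      ≈⟨ *-distribˡ-sum (x i) (λ j → y j * (½ℝ * E i j a b)) ⟩
    (∑ λ j → x i * (y j * (½ℝ * E i j a b)))
      ≈⟨ ∑-cong (λ j → pointwise λ t →
           solve 3 (λ x y e → x :* (y :* (con ℚ.½ :* e)) := con ℚ.½ :* (x :* y :* e)) refl
             (seq (x i) t) (seq (y j) t) (seq (E i j a b) t)) ⟩
    (∑ λ j → half a b i j) ∎

  columnʳ : ∀ a j b →
    y j * (∑ λ r → 𝑤 x y r a * 𝑀 E r (inʳ j b)) ≃ ∑ λ i → half a b i j
  columnʳ a j b = begin
    y j * (∑ λ r → 𝑤 x y r a * 𝑀 E r (inʳ j b))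
      ≈⟨ *-congˡ (y j) (∑-𝑤 x y a (λ r → 𝑀 E r (inʳ j b))) ⟩
    y j * ((∑ λ i → x i * 𝑀 E (inˡ i a) (inʳ j b)) + (∑ λ j′ → y j′ * 𝑀 E (inʳ j′ a) (inʳ j b)))
      ≈⟨ *-congˡ (y j) (+-cong
           (∑-cong λ i → *-congˡ (x i) (≡⇒≃ (𝑀ˡʳ i a j b)))
           (∑-vanish y (λ j′ → 𝑀 E (inʳ j′ a) (inʳ j b)) (λ j′ → 𝑀ʳʳ j′ a j b))) ⟩
    y j * ((∑ λ i → x i * (½ℝ * E i j a b)) + 0ℝ)
      ≈⟨ *-congˡ (y j) (+-identityʳ _) ⟩
    y j * (∑ λ i → x i * (½ℝ * E i j a b))
      ≈⟨ *-distribˡ-sum (y j) (λ i → x i * (½ℝ * E i j a b)) ⟩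
    (∑ λ i → y j * (x i * (½ℝ * E i j a b)))
      ≈⟨ ∑-cong (λ i → pointwise λ t →
           solve 3 (λ x y e → y :* (x :* (con ℚ.½ :* e)) := con ℚ.½ :* (x :* y :* e)) refl
             (seq (x i) t) (seq (y j) t) (seq (E i j a b) t)) ⟩
    (∑ λ i → half a b i j) ∎

  𝑀-𝑤-entry : ∀ a b →
    congruence (𝑀 E) (𝑤 x y) a b ≃ ∑ λ i → ∑ λ j → x i * y j * E i j a b
  𝑀-𝑤-entry a b = begin
    (∑ λ s → row s * 𝑤 x y s b)
      ≈⟨ ∑-cong (λ s → *-comm (row s) (𝑤 x y s b)) ⟩
    (∑ λ s → 𝑤 x y s b * row s)
      ≈⟨ ∑-𝑤 x y b row ⟩
    (∑ λ i → x i * row (inˡ i b)) + (∑ λ j → y j * row (inʳ j b))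
      ≈⟨ +-cong (∑-cong λ i → columnˡ a i b) (∑-cong λ j → columnʳ a j b) ⟩
    (∑ λ i → ∑ λ j → half a b i j) + (∑ λ j → ∑ λ i → half a b i j)
      -- The two halves arise with opposite orders of summation and must agree before they can be
      -- added termwise.
      ≈⟨ +-cong ≃-refl (∑-comm (half a b)) ⟨
    (∑ λ i → ∑ λ j → half a b i j) + (∑ λ i → ∑ λ j → half a b i j)
      ≈⟨ ∑-distrib-+ (λ i → ∑ (half a b i)) (λ i → ∑ (half a b i)) ⟨
    (∑ λ i → (∑ λ j → half a b i j) + (∑ λ j → half a b i j))
      ≈⟨ ∑-cong (λ i → ∑-distrib-+ (half a b i) (half a b i)) ⟨
    (∑ λ i → ∑ λ j → half a b i j + half a b i j)
      ≈⟨ ∑-cong (λ i → ∑-cong λ j → pointwise λ t →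
           solve 1 (λ e → con ℚ.½ :* e :+ con ℚ.½ :* e := e) refl
             (seq (x i * y j * E i j a b) t)) ⟩
    (∑ λ i → ∑ λ j → x i * y j * E i j a b) ∎
    where
    row : Vector ℝ (m ℕ.* p ℕ.+ n ℕ.* p)
    row s = ∑ λ r → 𝑤 x y r a * 𝑀 E r s

-- Positive and negative parts of a diagonal matrix

≃0⇒⊔0≃0 : ∀ x → x ≃ 0ℝ → x ⊔ 0ℝ ≃ 0ℝ
≃0⇒⊔0≃0 x x≃0 = ≃-trans
  (≃-sym (nonNeg⇒⊔0 x (nonNeg-resp-≃ (≃-sym x≃0) (pointwise-nonNeg 0ℝ λ _ → ℚ.≤-refl)))) x≃0

-- The maximum is taken at every entry, and off the diagonal `D` is 0 only up to `≈`, so `D ⁺` has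
-- to be shown diagonal again.
PSD-⁺ : (D : Matrix n n) → IsDiagonal D → IsPSD (D ⁺)
PSD-⁺ D D-diagonal = PSD-diagonal (D ⁺)
  (λ i j i≢j → ≃⇒≈ (≃0⇒⊔0≃0 (D i j) (≈⇒≃ (D-diagonal i j i≢j))))
  (λ i → pointwise-nonNeg (D i i ⊔ 0ℝ) λ t → ℚ.p≤q⊔p (seq (D i i) t) 0ℚ)

PSD-⁻ : (D : Matrix n n) → IsDiagonal D → IsPSD (D ⁻)
PSD-⁻ D D-diagonal = PSD-diagonal (D ⁻)
  (λ i j i≢j → ≃⇒≈ {(D ⁻) i j} {0ℝ} (off-diagonal i j i≢j))
  (λ i → pointwise-nonNeg ((D ⁻) i i) λ t → p≤q⇒0≤q-p (ℚ.p≤p⊔q (seq (D i i) t) 0ℚ))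
  where
  off-diagonal : ∀ i j → i ≢ j → D i j ⊔ 0ℝ - D i j ≃ 0ℝ
  off-diagonal i j i≢j = ≃-trans
    (+-cong (≃0⇒⊔0≃0 (D i j) D≃0) (-‿cong D≃0))
    (pointwise {0ℝ - 0ℝ} λ _ → refl)
    where
    D≃0 : D i j ≃ 0ℝ
    D≃0 = ≈⇒≃ (D-diagonal i j i≢j)

  p≤q⇒0≤q-p : ∀ {p q} → p ℚ.≤ q → 0ℚ ℚ.≤ q ℚ.- p
  p≤q⇒0≤q-p {p} {q} p≤q =
    subst (ℚ._≤ q ℚ.- p) (ℚ.+-inverseʳ p) (ℚ.+-monoˡ-≤ (ℚ.- p) p≤q)

-- The splitting of `D` in the form D⁺ = D⁻ + D, so that additivity of a single congruence by VW
-- suffices.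
congruence-⁺ : (V D : Matrix n n) (W : Matrix n p) →
  congruence (congruence (D ⁺) V) W
  ≅ congruence (congruence (D ⁻) V) W +ᴹ congruence (congruence D V) W
congruence-⁺ V D W = begin
  congruence (congruence (D ⁺) V) W
    ≈⟨ congruence-congruence (D ⁺) V W ⟩
  congruence (D ⁺) (V *ᴹ W)
    ≈⟨ congruence-cong (≋⇒≅ λ i j → pointwise λ t →
         solve 2 (λ d e → e := (e :- d) :+ d) refl (seq (D i j) t) (seq ((D ⁺) i j) t))
         (≅-refl {x = V *ᴹ W}) ⟩
  congruence (D ⁻ +ᴹ D) (V *ᴹ W)
    ≈⟨ congruence-+ᴹ (D ⁻) D (V *ᴹ W) ⟩
  congruence (D ⁻) (V *ᴹ W) +ᴹ congruence D (V *ᴹ W)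
    ≈⟨ +ᴹ-cong (congruence-congruence (D ⁻) V W) (congruence-congruence D V W) ⟨
  congruence (congruence (D ⁻) V) W +ᴹ congruence (congruence D V) W ∎
  where open ≅-Reasoning

theorem7 : ∀ (m n p : ℕ)
    (F : Matrix p p) (H : Vector (Matrix p p) m) (G : Vector (Matrix p p) n)
    (E : Fin m → Fin n → Matrix p p) →
    IsSymmetric F → (∀ i → IsSymmetric (H i)) → (∀ j → IsSymmetric (G j)) →
    (∀ i j → IsSymmetric (E i j)) →
    (V D : Matrix (m ℕ.* p ℕ.+ n ℕ.* p) (m ℕ.* p ℕ.+ n ℕ.* p)) →
    IsEigendecomposition (𝑀 E) V D →
    (∀ x y → ℬ F H G E x y ≋ ℬ⁺ F H G V D x y -ᴹ ℬ⁻ V D x y)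
    × PSDConvexOn U (onJoint {m} {n} {p} (ℬ⁺ F H G V D))
    × PSDConvexOn U (onJoint {m} {n} {p} (ℬ⁻ V D))
theorem7 m n p F H G E F-sym H-sym G-sym E-sym V D eig =
  (λ x y → ≅⇒≋ (decomposition x y)) , convex⁺ , convex⁻
  where
  open IsEigendecomposition eig

  Ω : Matrix p (m ℕ.* p ℕ.+ n ℕ.* p)
  Ω = blockRow H ∥ blockRow G

  linear : Vector ℝ m → Vector ℝ n → Matrix p p
  linear x y = ∑ᴹ (λ i → x i ·ᴹ H i) +ᴹ ∑ᴹ (λ j → y j ·ᴹ G j)

  M≅ : congruence D V ≅ 𝑀 E
  M≅ = ≅-sym (≋⇒≅ λ i j → ≈⇒≃ (factors i j))

  decomposition : ∀ x y → ℬ F H G E x y ≅ ℬ⁺ F H G V D x y -ᴹ ℬ⁻ V D x y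
  decomposition x y = begin
    F +ᴹ ∑ᴹ (λ i → x i ·ᴹ H i) +ᴹ ∑ᴹ (λ j → y j ·ᴹ G j) +ᴹ bil
      -- Adds and subtracts the value of `ℬ⁻`, so that its sum with `bil` can be recognised as the
      -- quadratic term of `ℬ⁺`.
      ≈⟨ ≋⇒≅ (λ a b → pointwise λ t →
           solve 5 (λ f h g e q → f :+ h :+ g :+ e := (q :+ e) :+ (h :+ g) :+ f :- q) refl
             (seq (F a b) t) (seq (∑ᴹ (λ i → x i ·ᴹ H i) a b) t)
             (seq (∑ᴹ (λ j → y j ·ᴹ G j) a b) t) (seq (bil a b) t)
             (seq (ℬ⁻ V D x y a b) t)) ⟩
    (ℬ⁻ V D x y +ᴹ bil) +ᴹ linear x y +ᴹ F -ᴹ ℬ⁻ V D x y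
      ≈⟨ -ᴹ-cong (+ᴹ-cong (+ᴹ-cong quadratic⁺ (Ω-𝑤 H G x y)) ≅-refl) ≅-refl ⟨
    ℬ⁺ F H G V D x y -ᴹ ℬ⁻ V D x y ∎
    where
    open ≅-Reasoning
    bil : Matrix p p
    bil = ∑ᴹ λ i → ∑ᴹ λ j → (x i * y j) ·ᴹ E i j

    quadratic⁺ : congruence (congruence (D ⁺) V) (𝑤 x y) ≅ ℬ⁻ V D x y +ᴹ bil
    quadratic⁺ = ≅-trans (congruence-⁺ V D (𝑤 x y))
      (+ᴹ-cong ≅-refl
        (≅-trans (congruence-cong M≅ (≅-refl {x = 𝑤 x y})) (𝑀-𝑤 E E-sym x y)))

  -- Symmetry is invisible in the product of rectangular matrices and comes from its expansion in
  -- the symmetric `H i` and `G j`.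
  Ω𝑤-symmetric : ∀ x y → IsSymmetric (Ω *ᴹ 𝑤 x y)
  Ω𝑤-symmetric x y = ≅⇒≋ (≅-trans (Ω-𝑤 H G x y)
    (≅-trans linear-symmetric (ᵀ-cong (≅-sym (Ω-𝑤 H G x y)))))
    where
    linear-symmetric : linear x y ≅ linear x y ᵀ
    linear-symmetric = ≋⇒≅ λ a b → +-cong
      (∑-cong λ i → *-congˡ (x i) (≈⇒≃ {H i a b} (H-sym i a b)))
      (∑-cong λ j → *-congˡ (y j) (≈⇒≃ {G j a b} (G-sym j a b)))

  𝐰 : Vector ℝ (m ℕ.+ n) → Matrix (m ℕ.* p ℕ.+ n ℕ.* p) p
  𝐰 z = 𝑤 (take m z) (drop m z)

  convex-quadratic : (S : Matrix (m ℕ.* p ℕ.+ n ℕ.* p) (m ℕ.* p ℕ.+ n ℕ.* p)) → IsPSD S →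
    PSDConvexOn U (λ z → congruence (congruence S V) (𝐰 z))
  convex-quadratic S S-psd = PSDConvex-congruence (congruence S V) 𝐰
    (PSD-congruence S V S-psd) (affine-𝑤 m n p)

  convex⁺ : PSDConvexOn U (onJoint {m} {n} {p} (ℬ⁺ F H G V D))
  convex⁺ = PSDConvex-+ᴹ (λ z → congruence (congruence (D ⁺) V) (𝐰 z) +ᴹ Ω *ᴹ 𝐰 z) (λ _ → F)
    (PSDConvex-+ᴹ (λ z → congruence (congruence (D ⁺) V) (𝐰 z)) (λ z → Ω *ᴹ 𝐰 z)
      (convex-quadratic (D ⁺) (PSD-⁺ D diagonal))
      (PSDConvex-affine (λ z → Ω *ᴹ 𝐰 z) (λ z → Ω𝑤-symmetric (take m z) (drop m z))
        (affine-*ᴹ Ω 𝐰 (affine-𝑤 m n p))))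
    (PSDConvex-affine (λ _ → F) (λ _ → F-sym) (affine-const F))

  convex⁻ : PSDConvexOn U (onJoint {m} {n} {p} (ℬ⁻ V D))
  convex⁻ = convex-quadratic (D ⁻) (PSD-⁻ D diagonal)
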